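{- Let $q$ be a complex number with $|q|<1$ and let $k\geqslant 1$ be an integer. Then $$\frac{(-q;q)_\infty}{(q;q)_\infty}\bigg(1+2\sum_{j=1}^k (-1)^j q^{j^2}\bigg) =1+(-1)^k \sum_{n=k+1}^\infty \frac{(-q;q)_{k}\, (-1;q)_{n-k}\,q^{(k+1)n}}{(q;q)_n}{n-1\brack k}_q.$$
   Context: The $q$-shifted factorials are $(a;q)_\infty=\prod_{n=0}^{\infty}(1-aq^n)$ and, for integers $M\geqslant 0$, $(a;q)_M=\dfrac{(a;q)_\infty}{(aq^M;q)_\infty}=\prod_{i=0}^{M-1}(1-aq^i)$. The $q$-binomial coefficient is, for integers $0\leqslant N\leqslant M$, ${M\brack N}_q=\dfrac{(q;q)_M}{(q;q)_N (q;q)_{M-N}}$. -}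

module Defs where

open import Data.Nat.Base as ℕ using (ℕ; zero; suc; z≤n; s≤s)
import Data.Nat.Properties as ℕ
open import Data.Integer.Base as ℤ using (+_; -[1+_])
import Data.Integer.Properties as ℤ
open import Data.Rational.Base as ℚ using (ℚ; 0ℚ; 1ℚ; ½; mkℚ)
import Data.Rational.Properties as ℚ
open import Data.Rational.Solver using (module +-*-Solver)
import Data.Rational.Unnormalised.Base as ℚᵘ
import Data.Rational.Unnormalised.Properties as ℚᵘ
open import Data.Product.Base using (Σ; ∃; _×_; _,_; proj₁; proj₂)
open import Data.Sum.Base using (_⊎_; inj₁; inj₂)
open import Level using (0ℓ)
open import Relation.Nullary using (¬_; yes; no; contradiction)
open import Relation.Unary using (Pred; Decidable)
open import Relation.Binary.PropositionalEquality
open import Algebra.Bundles.Raw using (RawRing)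
import Algebra.Definitions.RawSemiring as RawSemiringDefs

Eventually : (ℕ → Set) → Set
Eventually P = ∃ λ N → ∀ n → N ℕ.≤ n → P n

module Rational where
  open import Data.Rational.Base
    using (_+_; _*_; -_; _-_; ∣_∣; _<_; _≤_; Positive; positive; nonNegative)

  ∣∣-bound : ∀ {d ε} → d < ε → - d < ε → ∣ d ∣ < ε
  ∣∣-bound {d} d<ε -d<ε with ℚ.∣p∣≡p∨∣p∣≡-p d
  ... | inj₁ eq = subst (_< _) (sym eq) d<ε
  ... | inj₂ eq = subst (_< _) (sym eq) -d<ε

  p≤∣p∣ : ∀ p → p ≤ ∣ p ∣
  p≤∣p∣ p with ℚ.∣p∣≡p∨∣p∣≡-p p
  ... | inj₁ eq = ℚ.≤-reflexive (sym eq)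
  ... | inj₂ eq = ℚ.≤-trans p≤0 (ℚ.0≤∣p∣ p)
    where
    p≤0 : p ≤ 0ℚ
    p≤0 = subst (_≤ 0ℚ) (trans (cong -_ eq) (neg-neg p))
            (ℚ.neg-antimono-≤ (ℚ.0≤∣p∣ p))
      where
      neg-neg : ∀ p → - (- p) ≡ p
      neg-neg = solve 1 (λ p → :- (:- p) := p) refl where open +-*-Solver

  0<½*_ : ∀ {ε} → 0ℚ < ε → 0ℚ < ½ * ε
  0<½*_ {ε} 0<ε = ℚ.positive⁻¹ (½ * ε) ⦃ ℚ.pos*pos⇒pos ½ ε ⦃ positive 0<ε ⦄ ⦄

  ½+½ : ∀ ε → ½ * ε + ½ * ε ≡ ε
  ½+½ ε = trans (sym (ℚ.*-distribʳ-+ ε ½ ½)) (ℚ.*-identityˡ ε)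

  0<*0< : ∀ {p q} → 0ℚ < p → 0ℚ < q → 0ℚ < p * q
  0<*0< {p} {q} 0<p 0<q =
    ℚ.positive⁻¹ (p * q) ⦃ ℚ.pos*pos⇒pos p ⦃ positive 0<p ⦄ q ⦃ positive 0<q ⦄ ⦄

  0≤*0≤ : ∀ {p q} → 0ℚ ≤ p → 0ℚ ≤ q → 0ℚ ≤ p * q
  0≤*0≤ {p} {q} 0≤p 0≤q =
    ℚ.nonNegative⁻¹ (p * q)
      ⦃ ℚ.nonNeg*nonNeg⇒nonNeg p ⦃ nonNegative 0≤p ⦄ q ⦃ nonNegative 0≤q ⦄ ⦄

  *-mono-≤ : ∀ {p q r s} → 0ℚ ≤ p → 0ℚ ≤ s → p ≤ q → r ≤ s → p * r ≤ q * s
  *-mono-≤ {p} {q} {r} {s} 0≤p 0≤s p≤q r≤s =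
    ℚ.≤-trans (ℚ.*-monoˡ-≤-nonNeg p ⦃ nonNegative 0≤p ⦄ r≤s)
              (ℚ.*-monoʳ-≤-nonNeg s ⦃ nonNegative 0≤s ⦄ p≤q)

  quotient : ∀ {ε b} → 0ℚ < ε → 0ℚ < b → ∃ λ δ → 0ℚ < δ × b * δ ≡ ε
  quotient {ε} {b} 0<ε 0<b = ε * 1/b , 0<*0< 0<ε 0<1/b , eq
    where
    instance
      _ : Positive b
      _ = positive 0<b
      _ : ℚ.NonZero b
      _ = ℚ.pos⇒nonZero b
    1/b = ℚ.1/ b
    0<1/b : 0ℚ < 1/b
    0<1/b = ℚ.positive⁻¹ 1/b ⦃ ℚ.1/pos⇒pos b ⦄
    eq : b * (ε * 1/b) ≡ ε
    eq = begin
      b * (ε * 1/b)  ≡⟨ solve 3 (λ b ε c → b :* (ε :* c) := (b :* c) :* ε) refl b ε 1/b ⟩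
      (b * 1/b) * ε  ≡⟨ cong (_* ε) (ℚ.*-inverseʳ b) ⟩
      1ℚ * ε         ≡⟨ ℚ.*-identityˡ ε ⟩
      ε              ∎
      where open ≡-Reasoning
            open +-*-Solver

  -- Opaque, as _/_ normalises fractions and is expensive to unfold.
  opaque
    frac : ℕ → ℕ → ℚ
    frac s n = + s ℚ./ suc n

    frac-zero : ∀ n → frac 0 n ≡ 0ℚ
    frac-zero n = ℚ.fromℚᵘ-cong {ℚᵘ.mkℚᵘ (+ 0) n} {ℚᵘ.0ℚᵘ} (ℚᵘ.*≡* refl)

    frac-one : frac 1 0 ≡ 1ℚ
    frac-one = refl

    frac-suc : ∀ n s → frac (suc s) n ≡ frac s n + frac 1 n
    frac-suc n s = ℚ.toℚᵘ-injective (begin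
      ℚ.toℚᵘ (frac (suc s) n)                     ≈⟨ unfold (suc s) ⟩
      ℚᵘ.mkℚᵘ (+ suc s) n                         ≈⟨ ℚᵘ.*≡* eq ⟩
      ℚᵘ.mkℚᵘ (+ s) n ℚᵘ.+ ℚᵘ.mkℚᵘ (+ 1) n        ≈⟨ ℚᵘ.+-cong (unfold s) (unfold 1) ⟨
      ℚ.toℚᵘ (frac s n) ℚᵘ.+ ℚ.toℚᵘ (frac 1 n)    ≈⟨ ℚ.toℚᵘ-homo-+ (frac s n) (frac 1 n) ⟨
      ℚ.toℚᵘ (frac s n + frac 1 n)                ∎)
      where
      open ℚᵘ.≃-Reasoning
      unfold : ∀ s → ℚ.toℚᵘ (frac s n) ℚᵘ.≃ ℚᵘ.mkℚᵘ (+ s) n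
      unfold s = ℚ.toℚᵘ-fromℚᵘ (ℚᵘ.mkℚᵘ (+ s) n)
      eq : + suc s ℤ.* (+ suc n ℤ.* + suc n) ≡ (+ s ℤ.* + suc n ℤ.+ + 1 ℤ.* + suc n) ℤ.* + suc n
      eq = trans (sym (ℤ.*-assoc (+ suc s) (+ suc n) (+ suc n)))
             (cong (ℤ._* + suc n) (trans (cong (λ i → + i ℤ.* + suc n) (ℕ.+-comm 1 s))
                                         (ℤ.*-distribʳ-+ (+ suc n) (+ s) (+ 1))))

    frac-mono : ∀ s m t n → s ℕ.* suc n ℕ.≤ t ℕ.* suc m → frac s m ≤ frac t n
    frac-mono s m t n h = ℚ.toℚᵘ-cancel-≤
      (ℚᵘ.≤-respˡ-≃ (ℚᵘ.≃-sym (ℚ.toℚᵘ-fromℚᵘ (ℚᵘ.mkℚᵘ (+ s) m)))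
      (ℚᵘ.≤-respʳ-≃ (ℚᵘ.≃-sym (ℚ.toℚᵘ-fromℚᵘ (ℚᵘ.mkℚᵘ (+ t) n)))
        (ℚᵘ.*≤* (subst₂ ℤ._≤_ (ℤ.pos-* s (suc n)) (ℤ.pos-* t (suc m)) (ℤ.+≤+ h)))))

    archimedean : ∀ {ε} → 0ℚ < ε → Eventually (λ n → frac 1 n < ε)
    archimedean {mkℚ (+ zero) d c}  0<ε = contradiction (ℚ.positive 0<ε) λ ()
    archimedean {mkℚ -[1+ p ] d c}  0<ε = contradiction (ℚ.positive 0<ε) λ ()
    archimedean {ε@(mkℚ (+ suc p) d c)} 0<ε = suc d , λ n d<n →
      ℚ.toℚᵘ-cancel-< (ℚᵘ.<-respˡ-≃ (ℚᵘ.≃-sym (ℚ.toℚᵘ-fromℚᵘ (ℚᵘ.mkℚᵘ (+ 1) n)))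
        (ℚᵘ.*<* (ℤ.+<+ (ℕ.≤-trans (s≤s (subst (ℕ._≤ n) (sym (ℕ.*-identityˡ (suc d))) d<n))
                                   (ℕ.m≤m+n (suc n) (p ℕ.* suc n))))))

    a<frac : ∀ a → a < frac (suc ℤ.∣ ℚ.↥ a ∣) 0
    a<frac a@(mkℚ i d _) = ℚ.toℚᵘ-cancel-< (ℚᵘ.<-respʳ-≃
      (ℚᵘ.≃-sym (ℚ.toℚᵘ-fromℚᵘ (ℚᵘ.mkℚᵘ (+ suc ℤ.∣ i ∣) 0)))
      (ℚᵘ.*<* (ℤ.≤-<-trans (ℤ.≤-reflexive (ℤ.*-identityʳ i))
        (ℤ.≤-<-trans (i≤∣i∣ i) (ℤ.+<+ (ℕ.m≤m*n (suc ℤ.∣ i ∣) (suc d)))))))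
      where
      i≤∣i∣ : ∀ i → i ℤ.≤ + ℤ.∣ i ∣
      i≤∣i∣ (+ n)     = ℤ.≤-refl
      i≤∣i∣ -[1+ n ]  = ℤ.-≤+

  0≤frac : ∀ s n → 0ℚ ≤ frac s n
  0≤frac s n = subst (_≤ frac s n) (frac-zero n) (frac-mono 0 n s n z≤n)

open Rational

largest : {P : Pred ℕ 0ℓ} → Decidable P → ℕ → ℕ
largest P? zero    = zero
largest P? (suc B) with P? (suc B)
... | yes _ = suc B
... | no  _ = largest P? B

largest-sat : {P : Pred ℕ 0ℓ} (P? : Decidable P) → ∀ B → largest P? B ≡ 0 ⊎ P (largest P? B)
largest-sat P? zero = inj₁ refl
largest-sat P? (suc B) with P? (suc B)
... | yes p = inj₂ p
... | no  _ = largest-sat P? B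

largest-max : {P : Pred ℕ 0ℓ} (P? : Decidable P) → ∀ B → ¬ P (suc B) → ¬ P (suc (largest P? B))
largest-max P? zero    ¬p = ¬p
largest-max P? (suc B) ¬p with P? (suc B)
... | yes _  = ¬p
... | no ¬p′ = largest-max P? B ¬p′

module Approximation where
  open import Data.Rational.Base using (_+_; _*_; -_; _-_; ∣_∣; _<_; _≤_)

  SquareBelow : ℚ → ℕ → ℕ → Set
  SquareBelow a n s = frac s n * frac s n ≤ a

  squareBelow? : ∀ a n → Decidable (SquareBelow a n)
  squareBelow? a n s = frac s n * frac s n ℚ.≤? a

  -- With K > a an integer, K² > a, so s / (n + 1) > K is too large.
  searchBound : ℚ → ℕ → ℕ
  searchBound a n = suc ℤ.∣ ℚ.↥ a ∣ ℕ.* suc n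

  opaque
    -- The largest s such that (s / (n + 1))² ≤ a, or 0 if a < 0.
    sqrtNumerator : ℚ → ℕ → ℕ
    sqrtNumerator a n = largest (squareBelow? a n) (searchBound a n)

    sqrtNumerator-sat : ∀ a n → sqrtNumerator a n ≡ 0 ⊎ SquareBelow a n (sqrtNumerator a n)
    sqrtNumerator-sat a n = largest-sat (squareBelow? a n) (searchBound a n)

    sqrtNumerator-max : ∀ a n → ¬ SquareBelow a n (suc (searchBound a n)) →
                        ¬ SquareBelow a n (suc (sqrtNumerator a n))
    sqrtNumerator-max a n = largest-max (squareBelow? a n) (searchBound a n)

  √≈ : ℚ → ℕ → ℚ
  √≈ a n = frac (sqrtNumerator a n) n

  0≤√≈ : ∀ a n → 0ℚ ≤ √≈ a n
  0≤√≈ a n = 0≤frac (sqrtNumerator a n) n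

  √≈-lower : ∀ a n → 0ℚ < √≈ a n → √≈ a n * √≈ a n ≤ a
  √≈-lower a n 0<r with sqrtNumerator-sat a n
  ... | inj₂ s²≤a = s²≤a
  ... | inj₁ s≡0  = contradiction 0<r
    (ℚ.<-irrefl (sym (trans (cong (λ s → frac s n) s≡0) (frac-zero n))))

  √≈-upper : ∀ a n → a < (√≈ a n + frac 1 n) * (√≈ a n + frac 1 n)
  √≈-upper a n = subst (λ r → a < r * r) (frac-suc n (sqrtNumerator a n))
    (ℚ.≰⇒> (sqrtNumerator-max a n (λ r²≤a → ℚ.<-irrefl refl (ℚ.<-≤-trans bound r²≤a))))
    where
    K B : ℕ
    K = suc ℤ.∣ ℚ.↥ a ∣
    B = searchBound a n
    k r : ℚ
    k = frac K 0
    r = frac (suc B) n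
    k≤r : k ≤ r
    k≤r = frac-mono K 0 (suc B) n
      (ℕ.≤-trans (ℕ.n≤1+n B) (ℕ.≤-reflexive (sym (ℕ.*-identityʳ (suc B)))))
    1≤k : 1ℚ ≤ k
    1≤k = subst (_≤ k) frac-one (frac-mono 1 0 K 0 (s≤s z≤n))
    bound : a < r * r
    bound = ℚ.<-≤-trans (a<frac a)
      (ℚ.≤-trans (ℚ.≤-reflexive (sym (ℚ.*-identityʳ k)))
                 (*-mono-≤ (0≤frac K 0) (0≤frac (suc B) n) k≤r (ℚ.≤-trans 1≤k k≤r)))

  sqrt-close : ∀ {a b u v w ε} → 0ℚ < ε → 0ℚ ≤ v → 0ℚ ≤ w →
               (0ℚ < u → u * u ≤ a) → b < (v + w) * (v + w) →
               a - b < (½ * ε) * (½ * ε) → w < ½ * ε → u - v < ε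
  sqrt-close {a} {b} {u} {v} {w} {ε} 0<ε 0≤v 0≤w lower upper a-b<h² w<h =
    ℚ.≰⇒> λ ε≤u-v → ℚ.<-irrefl refl (ℚ.<-≤-trans a<[v+ε]² ([v+ε]²≤a ε≤u-v))
    where
    open ℚ.≤-Reasoning
    open +-*-Solver
    h = ½ * ε
    0<h : 0ℚ < h
    0<h = 0<½* 0<ε
    0≤h : 0ℚ ≤ h
    0≤h = ℚ.<⇒≤ 0<h

    [v+ε]²≤a : ε ≤ u - v → (v + ε) * (v + ε) ≤ a
    [v+ε]²≤a ε≤u-v = ℚ.≤-trans (*-mono-≤ 0≤v+ε (ℚ.<⇒≤ 0<u) v+ε≤u v+ε≤u) (lower 0<u)
      where
      v+ε≤u : v + ε ≤ u
      v+ε≤u = begin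
        v + ε        ≤⟨ ℚ.+-monoʳ-≤ v ε≤u-v ⟩
        v + (u - v)  ≡⟨ solve 2 (λ u v → v :+ (u :- v) := u) refl u v ⟩
        u            ∎
      0≤v+ε : 0ℚ ≤ v + ε
      0≤v+ε = ℚ.+-mono-≤ 0≤v (ℚ.<⇒≤ 0<ε)
      0<u : 0ℚ < u
      0<u = ℚ.<-≤-trans (ℚ.+-mono-≤-< 0≤v 0<ε) v+ε≤u

    v+w≤v+h : v + w ≤ v + h
    v+w≤v+h = ℚ.+-monoʳ-≤ v (ℚ.<⇒≤ w<h)

    0≤rest : 0ℚ ≤ (v + v + (h + h)) * h
    0≤rest = 0≤*0≤ (ℚ.+-mono-≤ (ℚ.+-mono-≤ 0≤v 0≤v) (ℚ.+-mono-≤ 0≤h 0≤h)) 0≤h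

    b<[v+h]² : b < (v + h) * (v + h)
    b<[v+h]² = ℚ.<-≤-trans upper
      (*-mono-≤ (ℚ.+-mono-≤ 0≤v 0≤w) (ℚ.+-mono-≤ 0≤v 0≤h) v+w≤v+h v+w≤v+h)

    expand : ∀ v h → (v + h) * (v + h) + h * h + (v + v + (h + h)) * h
                     ≡ (v + (h + h)) * (v + (h + h))
    expand = solve 2 (λ v h → (v :+ h) :* (v :+ h) :+ h :* h :+ (v :+ v :+ (h :+ h)) :* h
                              := (v :+ (h :+ h)) :* (v :+ (h :+ h))) refl

    a<[v+ε]² : a < (v + ε) * (v + ε)
    a<[v+ε]² = begin-strict
      a                                   ≡⟨ solve 2 (λ a b → b :+ (a :- b) := a) refl a b ⟨
      b + (a - b)                         <⟨ ℚ.+-mono-< b<[v+h]² a-b<h² ⟩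
      (v + h) * (v + h) + h * h           ≡⟨ ℚ.+-identityʳ _ ⟨
      (v + h) * (v + h) + h * h + 0ℚ      ≤⟨ ℚ.+-monoʳ-≤ ((v + h) * (v + h) + h * h) 0≤rest ⟩
      (v + h) * (v + h) + h * h + (v + v + (h + h)) * h  ≡⟨ expand v h ⟩
      (v + (h + h)) * (v + (h + h))       ≡⟨ cong (λ e → (v + e) * (v + e)) (½+½ ε) ⟩
      (v + ε) * (v + ε)                   ∎

  √≈-close : ∀ {a b ε} m n → 0ℚ < ε →
             a - b < (½ * ε) * (½ * ε) → frac 1 n < ½ * ε →
             √≈ a m - √≈ b n < ε
  √≈-close {a} {b} m n 0<ε =
    sqrt-close 0<ε (0≤√≈ b n) (0≤frac 1 n) (√≈-lower a m) (√≈-upper b n)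

-- The reals are Cauchy sequences of rationals, with _≈ᴿ_ as their equality.
module Real where
  open import Data.Rational.Base
    using (_+_; _*_; -_; _-_; ∣_∣; _<_; _≤_; Positive; positive; nonNegative)
  open Approximation

  Cauchy : (ℕ → ℚ) → Set
  Cauchy x = ∀ {ε} → 0ℚ < ε →
    ∃ λ N → ∀ m n → N ℕ.≤ m → N ℕ.≤ n → ∣ x m - x n ∣ < ε

  record ℝ : Set where
    field
      seq    : ℕ → ℚ
      cauchy : Cauchy seq

  open ℝ public

  infix 4 _≈ᴿ_ _<ᴿ_

  _≈ᴿ_ : ℝ → ℝ → Set
  x ≈ᴿ y = ∀ {ε} → 0ℚ < ε → Eventually λ n → ∣ seq x n - seq y n ∣ < ε

  _<ᴿ_ : ℝ → ℝ → Set
  x <ᴿ y = ∃ λ ε → 0ℚ < ε × Eventually λ n → seq x n + ε ≤ seq y n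

  one-sided : ∀ (x : ℕ → ℚ) →
    (∀ {ε} → 0ℚ < ε → ∃ λ N → ∀ m n → N ℕ.≤ m → N ℕ.≤ n → x m - x n < ε) → Cauchy x
  one-sided x h 0<ε with h 0<ε
  ... | N , p = N , λ m n N≤m N≤n →
    ∣∣-bound (p m n N≤m N≤n) (subst (_< _) (lem (x n) (x m)) (p n m N≤n N≤m))
    where
    lem : ∀ a b → a - b ≡ - (b - a)
    lem = solve 2 (λ a b → a :- b := :- (b :- a)) refl where open +-*-Solver

  upper : ∀ (x : ℕ → ℚ) → Cauchy x →
    ∀ {ε} → 0ℚ < ε → ∃ λ N → ∀ m n → N ℕ.≤ m → N ℕ.≤ n → x m - x n < ε
  upper x c 0<ε with c 0<ε
  ... | N , p = N , λ m n N≤m N≤n → ℚ.≤-<-trans (p≤∣p∣ (x m - x n)) (p m n N≤m N≤n)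

  ½*ε<ε : ∀ {ε} → 0ℚ < ε → ½ * ε < ε
  ½*ε<ε {ε} 0<ε = subst₂ _<_ (ℚ.+-identityʳ _) (½+½ ε) (ℚ.+-monoʳ-< (½ * ε) (0<½* 0<ε))

  bounded : ∀ x → Cauchy x → ∃ λ B → 0ℚ < B × Eventually λ n → ∣ x n ∣ ≤ B
  bounded x c with c {1ℚ} (ℚ.positive⁻¹ 1ℚ)
  ... | N , p = 1ℚ + ∣ x N ∣
              , ℚ.+-mono-<-≤ (ℚ.positive⁻¹ 1ℚ) (ℚ.0≤∣p∣ (x N))
              , N , λ n N≤n → begin
      ∣ x n ∣                  ≡⟨ cong ∣_∣ (lem (x n) (x N)) ⟨
      ∣ x n - x N + x N ∣      ≤⟨ ℚ.∣p+q∣≤∣p∣+∣q∣ (x n - x N) (x N) ⟩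
      ∣ x n - x N ∣ + ∣ x N ∣  ≤⟨ ℚ.+-mono-≤ (ℚ.<⇒≤ (p n N N≤n ℕ.≤-refl)) ℚ.≤-refl ⟩
      1ℚ + ∣ x N ∣             ∎
    where
    open ℚ.≤-Reasoning
    lem : ∀ a b → a - b + b ≡ a
    lem = solve 2 (λ a b → a :- b :+ b := a) refl where open +-*-Solver

  fromℚ : ℚ → ℝ
  fromℚ p = record
    { seq    = λ _ → p
    ; cauchy = λ 0<ε → 0 , λ _ _ _ _ → subst (_< _) (cong ∣_∣ (sym (ℚ.+-inverseʳ p))) 0<ε
    }

  0ᴿ 1ᴿ : ℝ
  0ᴿ = fromℚ 0ℚ
  1ᴿ = fromℚ 1ℚ

  infixl 6 _+ᴿ_ _-ᴿ_
  infixl 7 _*ᴿ_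
  infix  8 -ᴿ_

  _+ᴿ_ : ℝ → ℝ → ℝ
  seq    (x +ᴿ y) n = seq x n + seq y n
  cauchy (x +ᴿ y) = one-sided (λ n → seq x n + seq y n) λ {ε} 0<ε →
    let (M , p) = upper (seq x) (cauchy x) (0<½* 0<ε)
        (N , q) = upper (seq y) (cauchy y) (0<½* 0<ε)
    in M ℕ.⊔ N , λ m n ≤m ≤n → subst₂ _<_ (lem (seq x m) (seq x n) (seq y m) (seq y n)) (½+½ ε)
         (ℚ.+-mono-< (p m n (ℕ.m⊔n≤o⇒m≤o M N ≤m) (ℕ.m⊔n≤o⇒m≤o M N ≤n))
                     (q m n (ℕ.m⊔n≤o⇒n≤o M N ≤m) (ℕ.m⊔n≤o⇒n≤o M N ≤n)))
    where
    lem : ∀ a b c d → (a - b) + (c - d) ≡ (a + c) - (b + d)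
    lem = solve 4 (λ a b c d → (a :- b) :+ (c :- d) := (a :+ c) :- (b :+ d)) refl
      where open +-*-Solver

  -ᴿ_ : ℝ → ℝ
  seq    (-ᴿ x) n = - seq x n
  cauchy (-ᴿ x) = one-sided (λ n → - seq x n) λ 0<ε →
    let (N , p) = upper (seq x) (cauchy x) 0<ε
    in N , λ m n ≤m ≤n → subst (_< _) (lem (seq x n) (seq x m)) (p n m ≤n ≤m)
    where
    lem : ∀ a b → a - b ≡ (- b) - (- a)
    lem = solve 2 (λ a b → a :- b := (:- b) :- (:- a)) refl where open +-*-Solver

  _-ᴿ_ : ℝ → ℝ → ℝ
  x -ᴿ y = x +ᴿ (-ᴿ y)

  _*ᴿ_ : ℝ → ℝ → ℝ
  seq    (x *ᴿ y) n = seq x n * seq y n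
  cauchy (x *ᴿ y) = one-sided (λ n → seq x n * seq y n) λ {ε} 0<ε →
    let (A , 0<A , M , ∣x∣≤A) = bounded (seq x) (cauchy x)
        (B , 0<B , N , ∣y∣≤B) = bounded (seq y) (cauchy y)
        (δ , 0<δ , eq)        = quotient (0<½* 0<ε) (ℚ.+-mono-< 0<A 0<B)
        (M′ , p)              = cauchy x 0<δ
        (N′ , q)              = cauchy y 0<δ
        K = M ℕ.⊔ N
        K′ = M′ ℕ.⊔ N′
    in K ℕ.⊔ K′ , λ m n ≤m ≤n →
      let a = seq x m; b = seq x n; c = seq y m; d = seq y n
          ≤₁ = ∣x∣≤A m (ℕ.m⊔n≤o⇒m≤o M N (ℕ.m⊔n≤o⇒m≤o K K′ ≤m))
          ≤₂ = ∣y∣≤B n (ℕ.m⊔n≤o⇒n≤o M N (ℕ.m⊔n≤o⇒m≤o K K′ ≤n))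
          <₁ = p m n (ℕ.m⊔n≤o⇒m≤o M′ N′ (ℕ.m⊔n≤o⇒n≤o K K′ ≤m))
                     (ℕ.m⊔n≤o⇒m≤o M′ N′ (ℕ.m⊔n≤o⇒n≤o K K′ ≤n))
          <₂ = q m n (ℕ.m⊔n≤o⇒n≤o M′ N′ (ℕ.m⊔n≤o⇒n≤o K K′ ≤m))
                     (ℕ.m⊔n≤o⇒n≤o M′ N′ (ℕ.m⊔n≤o⇒n≤o K K′ ≤n))
      in begin-strict
        a * c - b * d                      ≡⟨ lem a b c d ⟩
        a * (c - d) + d * (a - b)          ≤⟨ ℚ.+-mono-≤ (∣*∣ a (c - d)) (∣*∣ d (a - b)) ⟩
        ∣ a ∣ * ∣ c - d ∣ + ∣ d ∣ * ∣ a - b ∣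
          ≤⟨ ℚ.+-mono-≤ (*-mono-≤ (ℚ.0≤∣p∣ a) (ℚ.<⇒≤ 0<δ) ≤₁ (ℚ.<⇒≤ <₂))
                        (*-mono-≤ (ℚ.0≤∣p∣ d) (ℚ.<⇒≤ 0<δ) ≤₂ (ℚ.<⇒≤ <₁)) ⟩
        A * δ + B * δ                      ≡⟨ ℚ.*-distribʳ-+ δ A B ⟨
        (A + B) * δ                        ≡⟨ eq ⟩
        ½ * ε                              <⟨ ½*ε<ε 0<ε ⟩
        ε                                  ∎
    where
    open ℚ.≤-Reasoning
    lem : ∀ a b c d → a * c - b * d ≡ a * (c - d) + d * (a - b)
    lem = solve 4 (λ a b c d → a :* c :- b :* d := a :* (c :- d) :+ d :* (a :- b)) refl
      where open +-*-Solver
    ∣*∣ : ∀ p q → p * q ≤ ∣ p ∣ * ∣ q ∣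
    ∣*∣ p q = ℚ.≤-trans (p≤∣p∣ (p * q)) (ℚ.≤-reflexive (ℚ.∣p*q∣≡∣p∣*∣q∣ p q))

  -- The value at 0 is irrelevant: it is used only for sequences bounded away from 0.
  inv : ℚ → ℚ
  inv p with p ℚ.≟ 0ℚ
  ... | yes _   = 0ℚ
  ... | no  p≢0 = ℚ.1/_ p ⦃ ℚ.≢-nonZero p≢0 ⦄

  *-inv : ∀ {p} → 0ℚ < p → p * inv p ≡ 1ℚ
  *-inv {p} 0<p with p ℚ.≟ 0ℚ
  ... | yes p≡0 = contradiction (subst (0ℚ <_) p≡0 0<p) (ℚ.<-irrefl refl)
  ... | no  p≢0 = ℚ.*-inverseʳ p ⦃ ℚ.≢-nonZero p≢0 ⦄

  recip : (x : ℝ) → 0ᴿ <ᴿ x → ℝ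
  seq    (recip x _) n = inv (seq x n)
  cauchy (recip x (c , 0<c , K , c≤)) = one-sided (λ n → inv (seq x n)) λ {ε} 0<ε →
    let (N , p) = upper (seq x) (cauchy x) (0<*0< 0<ε (0<*0< 0<c 0<c))
    in K ℕ.⊔ N , λ m n ≤m ≤n →
      let a = seq x m; b = seq x n
          c≤a : c ≤ a
          c≤a = subst (_≤ a) (ℚ.+-identityˡ c) (c≤ m (ℕ.m⊔n≤o⇒m≤o K N ≤m))
          c≤b : c ≤ b
          c≤b = subst (_≤ b) (ℚ.+-identityˡ c) (c≤ n (ℕ.m⊔n≤o⇒m≤o K N ≤n))
          0<a = ℚ.<-≤-trans 0<c c≤a
          0<b = ℚ.<-≤-trans 0<c c≤b
          0≤ab = ℚ.<⇒≤ (0<*0< 0<a 0<b)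
      in ℚ.*-cancelʳ-<-nonNeg (a * b) ⦃ nonNegative 0≤ab ⦄ (begin-strict
        (inv a - inv b) * (a * b)            ≡⟨ lem a b (inv a) (inv b) ⟩
        (a * inv a) * b - (b * inv b) * a    ≡⟨ cong₂ (λ i j → i * b - j * a) (*-inv 0<a) (*-inv 0<b) ⟩
        1ℚ * b - 1ℚ * a                      ≡⟨ cong₂ _-_ (ℚ.*-identityˡ b) (ℚ.*-identityˡ a) ⟩
        b - a                                <⟨ p n m (ℕ.m⊔n≤o⇒n≤o K N ≤n) (ℕ.m⊔n≤o⇒n≤o K N ≤m) ⟩
        ε * (c * c)                          ≤⟨ ℚ.*-monoˡ-≤-nonNeg ε ⦃ nonNegative (ℚ.<⇒≤ 0<ε) ⦄
                                                  (*-mono-≤ (ℚ.<⇒≤ 0<c) (ℚ.<⇒≤ 0<b) c≤a c≤b) ⟩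
        ε * (a * b)                          ∎)
    where
    open ℚ.≤-Reasoning
    lem : ∀ a b i j → (i - j) * (a * b) ≡ (a * i) * b - (b * j) * a
    lem = solve 4 (λ a b i j → (i :- j) :* (a :* b) := (a :* i) :* b :- (b :* j) :* a) refl
      where open +-*-Solver

  -- √ x is the square root of max(x, 0).
  √ : ℝ → ℝ
  seq    (√ x) n = √≈ (seq x n) n
  cauchy (√ x) = one-sided (λ n → √≈ (seq x n) n) λ {ε} 0<ε →
    let 0<½ε    = 0<½* 0<ε
        (M , p) = upper (seq x) (cauchy x) (0<*0< 0<½ε 0<½ε)
        (N , q) = archimedean 0<½ε
    in M ℕ.⊔ N , λ m n ≤m ≤n →
      √≈-close m n 0<ε (p m n (ℕ.m⊔n≤o⇒m≤o M N ≤m) (ℕ.m⊔n≤o⇒m≤o M N ≤n))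
                   (q n (ℕ.m⊔n≤o⇒n≤o M N ≤n))

open Real public

record ℂ : Set where
  constructor _+i_
  field
    re im : ℝ

open ℂ public

infix  4 _≈_
infixl 6 _+_ _-_
infixl 7 _*_
infix  8 -_

_≈_ : ℂ → ℂ → Set
z ≈ w = re z ≈ᴿ re w × im z ≈ᴿ im w

0ℂ 1ℂ : ℂ
0ℂ = 0ᴿ +i 0ᴿ
1ℂ = 1ᴿ +i 0ᴿ

_+_ _*_ : ℂ → ℂ → ℂ
z + w = (re z +ᴿ re w) +i (im z +ᴿ im w)
z * w = (re z *ᴿ re w -ᴿ im z *ᴿ im w) +i (re z *ᴿ im w +ᴿ im z *ᴿ re w)

-_ : ℂ → ℂ
- z = (-ᴿ re z) +i (-ᴿ im z)

_-_ : ℂ → ℂ → ℂ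
z - w = z + (- w)

normSq : ℂ → ℝ
normSq z = re z *ᴿ re z +ᴿ im z *ᴿ im z

∣_∣ : ℂ → ℝ
∣ z ∣ = √ (normSq z)

-- Constructively, z ≠ 0 has to be given in the positive form 0 < |z|².
NonZero : ℂ → Set
NonZero z = 0ᴿ <ᴿ normSq z

-- z / w = z w̄ / |w|²; the sequences representing the result do not depend on the proof.
infixl 7 _/_⟨_⟩
_/_⟨_⟩ : (z w : ℂ) → NonZero w → ℂ
z / w ⟨ w≠0 ⟩ = z * ((re w *ᴿ r) +i ((-ᴿ im w) *ᴿ r))
  where r = recip (normSq w) w≠0

NonZero-* : ∀ {z w} → NonZero z → NonZero w → NonZero (z * w)
NonZero-* {z} {w} (δ , 0<δ , M , p) (ε , 0<ε , N , q) =
  δ ℚ.* ε , 0<*0< 0<δ 0<ε , M ℕ.⊔ N , λ n ≤n →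
    let a = seq (re z) n; b = seq (im z) n; c = seq (re w) n; d = seq (im w) n
        δ≤ = subst (ℚ._≤ _) (ℚ.+-identityˡ δ) (p n (ℕ.m⊔n≤o⇒m≤o M N ≤n))
        ε≤ = subst (ℚ._≤ _) (ℚ.+-identityˡ ε) (q n (ℕ.m⊔n≤o⇒n≤o M N ≤n))
    in subst₂ ℚ._≤_ (sym (ℚ.+-identityˡ (δ ℚ.* ε))) (lem a b c d)
         (*-mono-≤ (ℚ.<⇒≤ 0<δ) (ℚ.≤-trans (ℚ.<⇒≤ 0<ε) ε≤) δ≤ ε≤)
  where
  lem : ∀ a b c d →
    (a ℚ.* a ℚ.+ b ℚ.* b) ℚ.* (c ℚ.* c ℚ.+ d ℚ.* d) ≡
    (a ℚ.* c ℚ.- b ℚ.* d) ℚ.* (a ℚ.* c ℚ.- b ℚ.* d) ℚ.+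
    (a ℚ.* d ℚ.+ b ℚ.* c) ℚ.* (a ℚ.* d ℚ.+ b ℚ.* c)
  lem = solve 4 (λ a b c d →
    (a :* a :+ b :* b) :* (c :* c :+ d :* d) :=
    (a :* c :- b :* d) :* (a :* c :- b :* d) :+
    (a :* d :+ b :* c) :* (a :* d :+ b :* c)) refl
    where open +-*-Solver

ℂ-rawRing : RawRing 0ℓ 0ℓ
ℂ-rawRing = record
  { Carrier = ℂ ; _≈_ = _≈_ ; _+_ = _+_ ; _*_ = _*_ ; -_ = -_ ; 0# = 0ℂ ; 1# = 1ℂ }

open RawSemiringDefs (RawRing.rawSemiring ℂ-rawRing) public using (_^_)

2ℂ : ℂ
2ℂ = 1ℂ + 1ℂ

-- Tolerances may be taken rational, since every positive real exceeds a positive rational.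
infix 4 _⟶_
_⟶_ : (ℕ → ℂ) → ℂ → Set
f ⟶ L = ∀ {ε} → 0ℚ ℚ.< ε → Eventually λ n → ∣ f n - L ∣ <ᴿ fromℚ ε

-- sum a N f = f a + f (a + 1) + ⋯ + f (a + N - 1), a sum of N terms.
sum : ℕ → ℕ → (ℕ → ℂ) → ℂ
sum a zero    f = 0ℂ
sum a (suc N) f = sum a N f + f (a ℕ.+ N)

-- f a + f (a + 1) + ⋯ = S, as convergence of the partial sums.
IsSum : ℕ → (ℕ → ℂ) → ℂ → Set
IsSum a f S = (λ N → sum a N f) ⟶ S

qfac : ℂ → ℂ → ℕ → ℂ
qfac a q zero    = 1ℂ
qfac a q (suc M) = qfac a q M * (1ℂ - a * q ^ M)

-- (a; q)_∞ = P, as convergence of the partial products (a; q)_M.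
IsQfac∞ : ℂ → ℂ → ℂ → Set
IsQfac∞ a q P = qfac a q ⟶ P

-- What is needed to divide by (q; q)_n; it holds whenever |q| < 1.
QfacNonZero : ℂ → Set
QfacNonZero q = ∀ n → NonZero (qfac q q n)

-- The Gaussian binomial coefficient [M over N]_q, meaningful for N ≤ M.
qbinom : (q : ℂ) → QfacNonZero q → ℕ → ℕ → ℂ
qbinom q nz M N =
  qfac q q M / (qfac q q N * qfac q q (M ℕ.∸ N))
    ⟨ NonZero-* {qfac q q N} {qfac q q (M ℕ.∸ N)} (nz N) (nz (M ℕ.∸ N)) ⟩

{-# OPTIONS --safe #-}
module Submission where

-- Writing R_j = (-q;q)_j / (q;q)_j, the n-th term of the series, n = k + 1 + i, is
--   Y k i = 2 R_k R_i q^((k+1)(k+1+i)) / (1 - q^(k+1+i)).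
-- The partial sums S k M = ∑_{i<M} Y k i satisfy the exact recurrence
--   S (k+1) M + S k (M+1) = 2 q^((k+1)²) (G k M + R_k R_M q^((k+1)M) / (1 - q^(k+1))),
-- where G k M = R_k (1 + q^(k+1)) ∑_{m<M} R_m q^((k+1)m) telescopes in k and differs from R_M by O(|q|^M).
-- By induction on k, S k M = (-1)^k (R_M (1 + 2 ∑_{j≤k} (-1)^j q^(j²)) - 1) + O(|q|^M).
--
-- A complex number is a sequence of Gaussian rationals on which all operations act pointwise. The
-- identities hold exactly at every index, and the error terms are bounded uniformly over |q| ≤ r for
-- a rational r < 1, so each limit can be taken along the diagonal: its m-th approximation is that of
-- the m-th partial sum or product.

-- The shift in the recurrence aligns the ranges: `S (suc k) M` and `S k (suc M)` both stop at n = k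
-- + 1 + M. Raising M therefore adds two terms with the same n and the same denominator 1 - q^n.
-- With a = q^(k+1) and b = q^(M+1), their sum over (1 - a)(1 - b)(1 - ab) has a numerator divisible
-- by 1 - ab = 1 - q^n, so only the denominators 1 - a and 1 - b survive. As G k M and R_M agree up
-- to a small error, the recurrence reads S_(k+1) + S_k = 2 q^((k+1)²) R_M plus an error. Solving it
-- from S_0 = R_M - 1 produces both the alternating signs and the truncated theta sum. Uniformity in
-- x is forced: a larger index changes the number of factors and also the rational approximation of
-- q, so a constant that depends on the approximation would be useless. It settles the divisions as
-- well: the product of the factors 1/(1 - q^j) is bounded, hence one constant keeps every (q;q)_n,
-- and with them (q;q)_∞, away from 0.

open import Defs hiding (_+_; _*_; -_; _-_; ∣_∣; _^_; _/_⟨_⟩; 2ℂ; normSq)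
open import Data.Nat.Base as ℕ using (ℕ; zero; suc; z≤n; s≤s; _∸_)
import Data.Nat.Properties as ℕ
open import Data.Rational.Base as ℚ using (ℚ; 0ℚ; 1ℚ; ½; _≤_; _<_; positive; nonNegative)
import Data.Rational.Properties as ℚ
open import Data.Rational.Solver using (module +-*-Solver)
open import Data.Product.Base using (∃; _×_; _,_; proj₁; proj₂; Σ-syntax; ∃-syntax)
open import Relation.Binary.PropositionalEquality
open import Relation.Nullary using (yes; no; contradiction)
open Rational

-- Order, squares and fractions in ℚ.

module Rationals where
  open import Data.Rational.Base using (_+_; _*_; -_; _-_)
  open import Algebra.Bundles using (module CommutativeRing)
  open +-*-Solver using (solve; _:+_; _:*_; _:-_; :-_; _:=_; con)
  open ℚ.≤-Reasoning

  open import Algebra.Properties.Semiring.Exp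
    (CommutativeRing.semiring ℚ.+-*-commutativeRing) public using (_^_; ^-homo-*)

  0≤1 : 0ℚ ≤ 1ℚ
  0≤1 = ℚ.nonNegative⁻¹ 1ℚ

  0<1 : 0ℚ < 1ℚ
  0<1 = ℚ.positive⁻¹ 1ℚ

  0≤+0≤ : ∀ {p q} → 0ℚ ≤ p → 0ℚ ≤ q → 0ℚ ≤ p + q
  0≤+0≤ = ℚ.+-mono-≤

  p≤p+q : ∀ p {q} → 0ℚ ≤ q → p ≤ p + q
  p≤p+q p {q} 0≤q = begin
    p      ≡⟨ ℚ.+-identityʳ p ⟨
    p + 0ℚ ≤⟨ ℚ.+-monoʳ-≤ p 0≤q ⟩
    p + q  ∎

  ≤⇒0≤- : ∀ {p q} → p ≤ q → 0ℚ ≤ q - p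
  ≤⇒0≤- {p} {q} p≤q = begin
    0ℚ     ≡⟨ ℚ.+-inverseʳ p ⟨
    p - p  ≤⟨ ℚ.+-monoˡ-≤ (- p) p≤q ⟩
    q - p  ∎

  0≤-⇒≤ : ∀ {p q} → 0ℚ ≤ q - p → p ≤ q
  0≤-⇒≤ {p} {q} 0≤d = begin
    p            ≤⟨ p≤p+q p 0≤d ⟩
    p + (q - p)  ≡⟨ solve 2 (λ p q → p :+ (q :- p) := q) refl p q ⟩
    q            ∎

  <⇒0<- : ∀ {p q} → p < q → 0ℚ < q - p
  <⇒0<- {p} {q} p<q = begin-strict
    0ℚ     ≡⟨ ℚ.+-inverseʳ p ⟨
    p - p  <⟨ ℚ.+-monoˡ-< (- p) p<q ⟩
    q - p  ∎

  0≤p² : ∀ p → 0ℚ ≤ p * p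
  0≤p² p = begin
    0ℚ                    ≤⟨ 0≤*0≤ (ℚ.0≤∣p∣ p) (ℚ.0≤∣p∣ p) ⟩
    ℚ.∣ p ∣ * ℚ.∣ p ∣     ≡⟨ ℚ.∣p*q∣≡∣p∣*∣q∣ p p ⟨
    ℚ.∣ p * p ∣           ≡⟨ ∣p²∣ ⟩
    p * p                 ∎
    where
    open import Data.Sum.Base using (inj₁; inj₂)
    ∣p²∣ : ℚ.∣ p * p ∣ ≡ p * p
    ∣p²∣ with ℚ.≤-total 0ℚ p
    ... | inj₁ 0≤p = ℚ.0≤p⇒∣p∣≡p (0≤*0≤ 0≤p 0≤p)
    ... | inj₂ p≤0 = ℚ.0≤p⇒∣p∣≡p (subst (0ℚ ≤_)
      (solve 1 (λ p → (:- p) :* (:- p) := p :* p) refl p)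
      (0≤*0≤ (ℚ.neg-antimono-≤ p≤0) (ℚ.neg-antimono-≤ p≤0)))

  square-cancel-≤ : ∀ {p q} → 0ℚ ≤ q → p * p ≤ q * q → p ≤ q
  square-cancel-≤ {p} {q} 0≤q p²≤q² with p ℚ.≤? q
  ... | yes p≤q = p≤q
  ... | no  p≰q = contradiction (begin-strict
    q * q  ≤⟨ ℚ.*-monoˡ-≤-nonNeg q ⦃ nonNegative 0≤q ⦄ (ℚ.<⇒≤ q<p) ⟩
    q * p  <⟨ ℚ.*-monoˡ-<-pos p ⦃ positive (ℚ.≤-<-trans 0≤q q<p) ⦄ q<p ⟩
    p * p  ≤⟨ p²≤q² ⟩
    q * q  ∎) (ℚ.<-irrefl refl)
    where q<p = ℚ.≰⇒> p≰q

  ∣∣-≤ : ∀ {p s} → 0ℚ ≤ s → p * p ≤ s * s → ℚ.∣ p ∣ ≤ s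
  ∣∣-≤ {p} {s} 0≤s p²≤s² = square-cancel-≤ 0≤s (begin
    ℚ.∣ p ∣ * ℚ.∣ p ∣   ≡⟨ ℚ.∣p*q∣≡∣p∣*∣q∣ p p ⟨
    ℚ.∣ p * p ∣         ≡⟨ ℚ.0≤p⇒∣p∣≡p (0≤p² p) ⟩
    p * p               ≤⟨ p²≤s² ⟩
    s * s               ∎)

  frac-* : ∀ s n → frac s n ≡ frac s 0 * frac 1 n
  frac-* zero    n = trans (frac-zero n)
    (sym (trans (cong (_* frac 1 n) (frac-zero 0)) (ℚ.*-zeroˡ (frac 1 n))))
  frac-* (suc s) n = begin-equality
    frac (suc s) n                     ≡⟨ frac-suc n s ⟩
    frac s n + frac 1 n                ≡⟨ cong (_+ frac 1 n) (frac-* s n) ⟩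
    frac s 0 * frac 1 n + frac 1 n     ≡⟨ solve 2 (λ a b → a :* b :+ b := (a :+ con 1ℚ) :* b) refl (frac s 0) (frac 1 n) ⟩
    (frac s 0 + 1ℚ) * frac 1 n         ≡⟨ cong (λ i → (frac s 0 + i) * frac 1 n) frac-one ⟨
    (frac s 0 + frac 1 0) * frac 1 n   ≡⟨ cong (_* frac 1 n) (frac-suc 0 s) ⟨
    frac (suc s) 0 * frac 1 n          ∎

  suc*frac : ∀ n → 1ℚ ≤ frac (suc n) 0 * frac 1 n
  suc*frac n = begin
    1ℚ                          ≡⟨ frac-one ⟨
    frac 1 0                    ≤⟨ frac-mono 1 0 (suc n) n (ℕ.≤-reflexive (ℕ.*-comm 1 (suc n))) ⟩
    frac (suc n) n              ≡⟨ frac-* (suc n) n ⟩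
    frac (suc n) 0 * frac 1 n   ∎

  1/_ : ∀ {p} → 0ℚ < p → ∃ λ i → 0ℚ < i × p * i ≡ 1ℚ
  1/ 0<p = quotient 0<1 0<p

  -- Geometric powers, sums and products for a ratio 0 ≤ r < 1.

  module Geometric {r : ℚ} (0≤r : 0ℚ ≤ r) (r<1 : r < 1ℚ) where

    r≤1 : r ≤ 1ℚ
    r≤1 = ℚ.<⇒≤ r<1

    0≤^ : ∀ n → 0ℚ ≤ r ^ n
    0≤^ zero    = 0≤1
    0≤^ (suc n) = 0≤*0≤ 0≤r (0≤^ n)

    ^-suc-≤ : ∀ n → r ^ suc n ≤ r ^ n
    ^-suc-≤ n = begin
      r * r ^ n   ≤⟨ ℚ.*-monoʳ-≤-nonNeg (r ^ n) ⦃ nonNegative (0≤^ n) ⦄ r≤1 ⟩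
      1ℚ * r ^ n  ≡⟨ ℚ.*-identityˡ _ ⟩
      r ^ n       ∎

    ^≤1 : ∀ n → r ^ n ≤ 1ℚ
    ^≤1 zero    = ℚ.≤-refl
    ^≤1 (suc n) = ℚ.≤-trans (^-suc-≤ n) (^≤1 n)

    ^-antimono : ∀ {m n} → m ℕ.≤ n → r ^ n ≤ r ^ m
    ^-antimono {n = n} z≤n             = ^≤1 n
    ^-antimono         (s≤s {m} {n} p) = ℚ.*-monoˡ-≤-nonNeg r ⦃ nonNegative 0≤r ⦄ (^-antimono {m} {n} p)

    -- Bernoulli's inequality without division: from n to n + 1 the left-hand side drops by r^n
    -- (1-r)² (n+1), and it starts at 1.
    bernoulli : ∀ n → r ^ n * (1ℚ + frac n 0 * (1ℚ - r)) ≤ 1ℚ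
    bernoulli zero = ℚ.≤-reflexive (trans (cong (λ z → 1ℚ * (1ℚ + z * (1ℚ - r))) (frac-zero 0))
      (solve 1 (λ r → con 1ℚ :* (con 1ℚ :+ con 0ℚ :* (con 1ℚ :- r)) := con 1ℚ) refl r))
    bernoulli (suc n) = begin
      r * r ^ n * (1ℚ + frac (suc n) 0 * d)         ≡⟨ cong (λ s → r * r ^ n * (1ℚ + s * d))
                                                         (trans (frac-suc 0 n) (cong (frac n 0 +_) frac-one)) ⟩
      r * r ^ n * (1ℚ + (frac n 0 + 1ℚ) * d)        ≤⟨ p≤p+q _ 0≤rest ⟩
      r * r ^ n * (1ℚ + (frac n 0 + 1ℚ) * d) + r ^ n * (d * d * (frac n 0 + 1ℚ))
        ≡⟨ solve 3 (λ r p s → r :* p :* (con 1ℚ :+ (s :+ con 1ℚ) :* (con 1ℚ :- r))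
                              :+ p :* ((con 1ℚ :- r) :* (con 1ℚ :- r) :* (s :+ con 1ℚ))
                           := p :* (con 1ℚ :+ s :* (con 1ℚ :- r))) refl r (r ^ n) (frac n 0) ⟩
      r ^ n * (1ℚ + frac n 0 * d)                   ≤⟨ bernoulli n ⟩
      1ℚ                                            ∎
      where
      d = 1ℚ - r
      0≤rest : 0ℚ ≤ r ^ n * (d * d * (frac n 0 + 1ℚ))
      0≤rest = 0≤*0≤ (0≤^ n) (0≤*0≤ (0≤p² d) (0≤+0≤ (0≤frac n 0) 0≤1))

    ^-null : ∀ {ε} → 0ℚ < ε → Eventually λ n → r ^ n < ε
    ^-null {ε} 0<ε = suc N , λ n N<n → ℚ.≤-<-trans (^-antimono N<n) r^[1+N]<ε
      where
      d = 1ℚ - r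
      0<d : 0ℚ < d
      0<d = <⇒0<- r<1
      -- With 1/(N+1) < ε (1-r), the Bernoulli factor 1 + (N+1)(1-r) exceeds 1/ε.
      arch = archimedean (0<*0< 0<ε 0<d)
      N = proj₁ arch
      s = frac (suc N) 0
      0<1+sd : 0ℚ < 1ℚ + s * d
      0<1+sd = ℚ.+-mono-<-≤ 0<1 (0≤*0≤ (0≤frac (suc N) 0) (ℚ.<⇒≤ 0<d))
      r^[1+N]<ε : r ^ suc N < ε
      r^[1+N]<ε = ℚ.*-cancelʳ-<-nonNeg (1ℚ + s * d) ⦃ nonNegative (ℚ.<⇒≤ 0<1+sd) ⦄ (begin-strict
        r ^ suc N * (1ℚ + s * d)  ≤⟨ bernoulli (suc N) ⟩
        1ℚ                        ≤⟨ suc*frac N ⟩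
        s * frac 1 N              ≤⟨ ℚ.*-monoˡ-≤-nonNeg s ⦃ nonNegative (0≤frac (suc N) 0) ⦄
                                       (ℚ.<⇒≤ (proj₂ arch N ℕ.≤-refl)) ⟩
        s * (ε * d)               ≡⟨ ℚ.+-identityˡ _ ⟨
        0ℚ + s * (ε * d)          <⟨ ℚ.+-monoˡ-< (s * (ε * d)) 0<ε ⟩
        ε + s * (ε * d)           ≡⟨ solve 3 (λ e s d → e :+ s :* (e :* d) := e :* (con 1ℚ :+ s :* d)) refl ε s d ⟩
        ε * (1ℚ + s * d)          ∎)

    *^-null : ∀ D {ε} → 0ℚ ≤ D → 0ℚ < ε → Eventually λ n → D * r ^ n < ε
    *^-null D {ε} 0≤D 0<ε = let N , p = ^-null 0<δ in N , λ n N≤n → begin-strict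
      D * r ^ n       ≤⟨ ℚ.*-monoʳ-≤-nonNeg (r ^ n) ⦃ nonNegative (0≤^ n) ⦄ (p≤p+q D 0≤1) ⟩
      (D + 1ℚ) * r ^ n <⟨ ℚ.*-monoʳ-<-pos (D + 1ℚ) ⦃ positive 0<D+1 ⦄ (p n N≤n) ⟩
      (D + 1ℚ) * δ    ≡⟨ eq ⟩
      ε               ∎
      where
      -- `D` may be 0, so ε is divided by `D + 1` instead.
      0<D+1 : 0ℚ < D + 1ℚ
      0<D+1 = ℚ.+-mono-≤-< 0≤D 0<1
      δ = proj₁ (quotient 0<ε 0<D+1)
      0<δ = proj₁ (proj₂ (quotient 0<ε 0<D+1))
      eq = proj₂ (proj₂ (quotient 0<ε 0<D+1))

    geo : ℕ → ℚ
    geo zero    = 0ℚ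
    geo (suc n) = geo n + r ^ n

    geo-closed : ∀ n → (1ℚ - r) * geo n ≡ 1ℚ - r ^ n
    geo-closed zero    = solve 1 (λ r → (con 1ℚ :- r) :* con 0ℚ := con 1ℚ :- con 1ℚ) refl r
    geo-closed (suc n) = begin-equality
      (1ℚ - r) * (geo n + r ^ n)                ≡⟨ ℚ.*-distribˡ-+ (1ℚ - r) (geo n) (r ^ n) ⟩
      (1ℚ - r) * geo n + (1ℚ - r) * r ^ n       ≡⟨ cong (_+ (1ℚ - r) * r ^ n) (geo-closed n) ⟩
      1ℚ - r ^ n + (1ℚ - r) * r ^ n             ≡⟨ solve 2 (λ r p → con 1ℚ :- p :+ (con 1ℚ :- r) :* p := con 1ℚ :- r :* p) refl r (r ^ n) ⟩
      1ℚ - r * r ^ n                            ∎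

    geo-total : ∃ λ g → 0ℚ < g × (1ℚ - r) * g ≡ 1ℚ
    geo-total = 1/ <⇒0<- r<1

    g : ℚ
    g = proj₁ geo-total

    0≤g : 0ℚ ≤ g
    0≤g = ℚ.<⇒≤ (proj₁ (proj₂ geo-total))

    geo≤g : ∀ n → geo n ≤ g
    geo≤g n = ℚ.*-cancelˡ-≤-pos (1ℚ - r) ⦃ positive (<⇒0<- r<1) ⦄ (begin
      (1ℚ - r) * geo n   ≡⟨ geo-closed n ⟩
      1ℚ - r ^ n         ≤⟨ 0≤-⇒≤ (subst (0ℚ ≤_) (solve 1 (λ p → p := con 1ℚ :- (con 1ℚ :- p)) refl (r ^ n)) (0≤^ n)) ⟩
      1ℚ                 ≡⟨ proj₂ (proj₂ geo-total) ⟨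
      (1ℚ - r) * g       ∎)

    geoProd : ℚ → ℕ → ℚ
    geoProd K zero    = 1ℚ
    geoProd K (suc n) = geoProd K n * (1ℚ + K * r ^ n)

    -- Splitting off the first factor instead of the last leaves a product of the same kind, with
    -- `K * r` in place of `K`.
    geoProd-shift : ∀ K n → geoProd K (suc n) ≡ (1ℚ + K) * geoProd (K * r) n
    geoProd-shift K zero    = solve 1 (λ k → con 1ℚ :* (con 1ℚ :+ k :* con 1ℚ) := (con 1ℚ :+ k) :* con 1ℚ) refl K
    geoProd-shift K (suc n) = begin-equality
      geoProd K (suc n) * (1ℚ + K * (r * r ^ n))    ≡⟨ cong (_* (1ℚ + K * (r * r ^ n))) (geoProd-shift K n) ⟩
      (1ℚ + K) * geoProd (K * r) n * (1ℚ + K * (r * r ^ n))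
        ≡⟨ solve 4 (λ k r p q → (con 1ℚ :+ k) :* q :* (con 1ℚ :+ k :* (r :* p))
                             := (con 1ℚ :+ k) :* (q :* (con 1ℚ :+ k :* r :* p))) refl K r (r ^ n) (geoProd (K * r) n) ⟩
      (1ℚ + K) * geoProd (K * r) (suc n)            ∎

    1≤1+ : ∀ K → 0ℚ ≤ K → ∀ n → 1ℚ ≤ 1ℚ + K * r ^ n
    1≤1+ K 0≤K n = p≤p+q 1ℚ (0≤*0≤ 0≤K (0≤^ n))

    0≤geoProd : ∀ K → 0ℚ ≤ K → ∀ n → 0ℚ ≤ geoProd K n
    0≤geoProd K 0≤K zero    = 0≤1
    0≤geoProd K 0≤K (suc n) = 0≤*0≤ (0≤geoProd K 0≤K n) (ℚ.≤-trans 0≤1 (1≤1+ K 0≤K n))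

    geoProd-suc-≥ : ∀ K → 0ℚ ≤ K → ∀ n → geoProd K n ≤ geoProd K (suc n)
    geoProd-suc-≥ K 0≤K n = begin
      geoProd K n        ≡⟨ ℚ.*-identityʳ _ ⟨
      geoProd K n * 1ℚ   ≤⟨ ℚ.*-monoˡ-≤-nonNeg (geoProd K n) ⦃ nonNegative (0≤geoProd K 0≤K n) ⦄ (1≤1+ K 0≤K n) ⟩
      geoProd K (suc n)  ∎

    -- The factor 2 makes the linear bound inductive: in the expanded product the cross term K r^n ·
    -- 2K · `geo n` is at most K r^n, because 2K g ≤ 1.
    geoProd-bounded-small : ∀ K → 0ℚ ≤ K → (K + K) * g ≤ 1ℚ → ∀ n → geoProd K n ≤ 1ℚ + (K + K) * geo n
    geoProd-bounded-small K 0≤K small zero    =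
      ℚ.≤-reflexive (solve 1 (λ k → con 1ℚ := con 1ℚ :+ (k :+ k) :* con 0ℚ) refl K)
    geoProd-bounded-small K 0≤K small (suc n) = begin
      geoProd K n * (1ℚ + K * r ^ n)
        ≤⟨ ℚ.*-monoʳ-≤-nonNeg _ ⦃ nonNegative (ℚ.≤-trans 0≤1 (1≤1+ K 0≤K n)) ⦄ (geoProd-bounded-small K 0≤K small n) ⟩
      (1ℚ + 2K * geo n) * (1ℚ + K * r ^ n)
        ≡⟨ solve 3 (λ k s p → (con 1ℚ :+ (k :+ k) :* s) :* (con 1ℚ :+ k :* p)
             := con 1ℚ :+ (k :+ k) :* s :+ k :* p :+ k :* p :* ((k :+ k) :* s)) refl K (geo n) (r ^ n) ⟩
      1ℚ + 2K * geo n + K * r ^ n + K * r ^ n * (2K * geo n)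
        ≤⟨ ℚ.+-monoʳ-≤ (1ℚ + 2K * geo n + K * r ^ n)
             (ℚ.*-monoˡ-≤-nonNeg (K * r ^ n) ⦃ nonNegative (0≤*0≤ 0≤K (0≤^ n)) ⦄ 2K*geo≤1) ⟩
      1ℚ + 2K * geo n + K * r ^ n + K * r ^ n * 1ℚ
        ≡⟨ solve 3 (λ k s p → con 1ℚ :+ (k :+ k) :* s :+ k :* p :+ k :* p :* con 1ℚ
             := con 1ℚ :+ (k :+ k) :* (s :+ p)) refl K (geo n) (r ^ n) ⟩
      1ℚ + 2K * geo (suc n) ∎
      where
      2K = K + K
      2K*geo≤1 : 2K * geo n ≤ 1ℚ
      2K*geo≤1 = ℚ.≤-trans (ℚ.*-monoˡ-≤-nonNeg 2K ⦃ nonNegative (0≤+0≤ 0≤K 0≤K) ⦄ (geo≤g n)) small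

    -- A rational substitute for the bound by the exponential of a geometric sum: after m factors
    -- are split off, `K` has become K r^m, which is small enough for `geoProd-bounded-small` once m
    -- is large. In `go`, `m` counts the factors still to be split off.
    geoProd-bounded : ∀ K → 0ℚ ≤ K → ∃ λ C → ∀ n → geoProd K n ≤ C
    geoProd-bounded K 0≤K = let N , p = *^-null ((K + K) * g) (0≤*0≤ (0≤+0≤ 0≤K 0≤K) 0≤g) 0<1
                            in go N K 0≤K (ℚ.<⇒≤ (p N ℕ.≤-refl))
      where
      go : ∀ m K → 0ℚ ≤ K → (K + K) * g * r ^ m ≤ 1ℚ → ∃ λ C → ∀ n → geoProd K n ≤ C
      go zero    K 0≤K small = 1ℚ + (K + K) * g , λ n → ℚ.≤-trans
        (geoProd-bounded-small K 0≤K (subst (_≤ 1ℚ) (ℚ.*-identityʳ _) small) n)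
        (ℚ.+-monoʳ-≤ 1ℚ (ℚ.*-monoˡ-≤-nonNeg (K + K) ⦃ nonNegative (0≤+0≤ 0≤K 0≤K) ⦄ (geo≤g n)))
      go (suc m) K 0≤K small =
        let C , p = go m (K * r) (0≤*0≤ 0≤K 0≤r)
              (subst (_≤ 1ℚ) (solve 4 (λ k g r p → (k :+ k) :* g :* (r :* p) := (k :* r :+ k :* r) :* g :* p)
                 refl K g r (r ^ m)) small)
        in (1ℚ + K) * C , λ n → begin
          geoProd K n                  ≤⟨ geoProd-suc-≥ K 0≤K n ⟩
          geoProd K (suc n)            ≡⟨ geoProd-shift K n ⟩
          (1ℚ + K) * geoProd (K * r) n ≤⟨ ℚ.*-monoˡ-≤-nonNeg (1ℚ + K) ⦃ nonNegative (0≤+0≤ 0≤1 0≤K) ⦄ (p n) ⟩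
          (1ℚ + K) * C                 ∎

-- Gaussian rationals; without η, so that arithmetic on variables does not unfold.
record 𝔾 : Set where
  no-eta-equality
  pattern
  constructor _⊹_
  field
    Re Im : ℚ

open 𝔾 public

-- The commutative ring of Gaussian rationals and its solver.

module Gaussian where
  open import Algebra.Bundles using (CommutativeRing)
  open +-*-Solver using (solve; _:+_; _:*_; _:-_; :-_; _:=_; con)
  open import Algebra.Structures {A = 𝔾} _≡_ using (IsCommutativeRing)
  open import Data.Maybe.Base using (Maybe; just; nothing)
  import Algebra.Solver.Ring
  open import Algebra.Solver.Ring.AlmostCommutativeRing
    using (fromCommutativeRing; _-Raw-AlmostCommutative⟶_)

  infixl 6 _+_ _-_
  infixl 7 _*_
  infix  8 -_

  _+_ _*_ : 𝔾 → 𝔾 → 𝔾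
  (a ⊹ b) + (c ⊹ d) = (a ℚ.+ c) ⊹ (b ℚ.+ d)
  (a ⊹ b) * (c ⊹ d) = (a ℚ.* c ℚ.- b ℚ.* d) ⊹ (a ℚ.* d ℚ.+ b ℚ.* c)

  -_ : 𝔾 → 𝔾
  - (a ⊹ b) = (ℚ.- a) ⊹ (ℚ.- b)

  _-_ : 𝔾 → 𝔾 → 𝔾
  x - y = x + (- y)

  rational : ℚ → 𝔾
  rational a = a ⊹ 0ℚ

  0# 1# 2# : 𝔾
  0# = rational 0ℚ
  1# = rational 1ℚ
  2# = 1# + 1#

  private
    isCommutativeRing : IsCommutativeRing _+_ _*_ (λ x → - x) 0# 1#
    isCommutativeRing = record
      { isRing = record
        { +-isAbelianGroup = record
          { isGroup = record
            { isMonoid = record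
              { isSemigroup = record
                { isMagma = record { isEquivalence = isEquivalence ; ∙-cong = cong₂ _+_ }
                ; assoc = λ { (a ⊹ b) (c ⊹ d) (e ⊹ f) → cong₂ _⊹_ (ℚ.+-assoc a c e) (ℚ.+-assoc b d f) }
                }
              ; identity = (λ { (a ⊹ b) → cong₂ _⊹_ (ℚ.+-identityˡ a) (ℚ.+-identityˡ b) })
                         , (λ { (a ⊹ b) → cong₂ _⊹_ (ℚ.+-identityʳ a) (ℚ.+-identityʳ b) })
              }
            ; inverse = (λ { (a ⊹ b) → cong₂ _⊹_ (ℚ.+-inverseˡ a) (ℚ.+-inverseˡ b) })
                      , (λ { (a ⊹ b) → cong₂ _⊹_ (ℚ.+-inverseʳ a) (ℚ.+-inverseʳ b) })
            ; ⁻¹-cong = cong (λ x → - x)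
            }
          ; comm = λ { (a ⊹ b) (c ⊹ d) → cong₂ _⊹_ (ℚ.+-comm a c) (ℚ.+-comm b d) }
          }
        ; *-cong = cong₂ _*_
        ; *-assoc = assoc
        ; *-identity = idˡ , idʳ
        ; distrib = distˡ , distʳ
        }
      ; *-comm = λ { (a ⊹ b) (c ⊹ d) → cong₂ _⊹_
          (solve 4 (λ a b c d → a :* c :- b :* d := c :* a :- d :* b) refl a b c d)
          (solve 4 (λ a b c d → a :* d :+ b :* c := c :* b :+ d :* a) refl a b c d) }
      }
      where
      assoc : ∀ x y z → (x * y) * z ≡ x * (y * z)
      assoc (a ⊹ b) (c ⊹ d) (e ⊹ f) = cong₂ _⊹_
        (solve 6 (λ a b c d e f → (a :* c :- b :* d) :* e :- (a :* d :+ b :* c) :* f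
                 := a :* (c :* e :- d :* f) :- b :* (c :* f :+ d :* e)) refl a b c d e f)
        (solve 6 (λ a b c d e f → (a :* c :- b :* d) :* f :+ (a :* d :+ b :* c) :* e
                 := a :* (c :* f :+ d :* e) :+ b :* (c :* e :- d :* f)) refl a b c d e f)
      idˡ : ∀ x → 1# * x ≡ x
      idˡ (a ⊹ b) = cong₂ _⊹_
        (solve 2 (λ a b → con 1ℚ :* a :- con 0ℚ :* b := a) refl a b)
        (solve 2 (λ a b → con 1ℚ :* b :+ con 0ℚ :* a := b) refl a b)
      idʳ : ∀ x → x * 1# ≡ x
      idʳ (a ⊹ b) = cong₂ _⊹_
        (solve 2 (λ a b → a :* con 1ℚ :- b :* con 0ℚ := a) refl a b)
        (solve 2 (λ a b → a :* con 0ℚ :+ b :* con 1ℚ := b) refl a b)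
      distˡ : ∀ x y z → x * (y + z) ≡ x * y + x * z
      distˡ (a ⊹ b) (c ⊹ d) (e ⊹ f) = cong₂ _⊹_
        (solve 6 (λ a b c d e f → a :* (c :+ e) :- b :* (d :+ f)
                 := a :* c :- b :* d :+ (a :* e :- b :* f)) refl a b c d e f)
        (solve 6 (λ a b c d e f → a :* (d :+ f) :+ b :* (c :+ e)
                 := a :* d :+ b :* c :+ (a :* f :+ b :* e)) refl a b c d e f)
      distʳ : ∀ z x y → (x + y) * z ≡ x * z + y * z
      distʳ (a ⊹ b) (c ⊹ d) (e ⊹ f) = cong₂ _⊹_
        (solve 6 (λ a b c d e f → (c :+ e) :* a :- (d :+ f) :* b
                 := c :* a :- d :* b :+ (e :* a :- f :* b)) refl a b c d e f)
        (solve 6 (λ a b c d e f → (c :+ e) :* b :+ (d :+ f) :* a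
                 := c :* b :+ d :* a :+ (e :* b :+ f :* a)) refl a b c d e f)

  commutativeRing : CommutativeRing _ _
  commutativeRing = record { isCommutativeRing = isCommutativeRing }

  open CommutativeRing commutativeRing public
    using (*-assoc; *-comm; *-identityˡ; *-identityʳ)
  open import Algebra.Properties.Semiring.Exp (CommutativeRing.semiring commutativeRing) public
    using (_^_; ^-homo-*; ^-assocʳ)

  private
    rational-morphism : ℚ.+-*-rawRing -Raw-AlmostCommutative⟶ fromCommutativeRing commutativeRing
    rational-morphism = record
      { ⟦_⟧    = rational
      ; +-homo = λ a b → cong₂ _⊹_ refl refl
      ; *-homo = λ a b → cong₂ _⊹_
          (solve 2 (λ a b → a :* b := a :* b :- con 0ℚ :* con 0ℚ) refl a b)
          (solve 2 (λ a b → con 0ℚ := a :* con 0ℚ :+ con 0ℚ :* b) refl a b)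
      ; -‿homo = λ a → refl
      ; 0-homo = refl
      ; 1-homo = refl
      }

    rational≟ : ∀ a b → Maybe (rational a ≡ rational b)
    rational≟ a b with a ℚ.≟ b
    ... | yes eq = just (cong rational eq)
    ... | no  _  = nothing

  module Solver = Algebra.Solver.Ring
    ℚ.+-*-rawRing (fromCommutativeRing commutativeRing) rational-morphism rational≟

-- Absolute values of Gaussian rationals, bounded through squares.

module Norm where
  open Gaussian
  open Rationals using (0≤+0≤; 0≤1; 0<1; 1/_; 0≤p²; p≤p+q; ≤⇒0≤-; square-cancel-≤; ∣∣-≤) renaming (_^_ to _^ℚ_)
  open +-*-Solver using (solve; _:+_; _:*_; _:-_; :-_; _:=_; con)

  normSq : 𝔾 → ℚ
  normSq (a ⊹ b) = a ℚ.* a ℚ.+ b ℚ.* b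

  normSq-* : ∀ z w → normSq (z * w) ≡ normSq z ℚ.* normSq w
  normSq-* (a ⊹ b) (c ⊹ d) = solve 4 (λ a b c d →
    (a :* c :- b :* d) :* (a :* c :- b :* d) :+ (a :* d :+ b :* c) :* (a :* d :+ b :* c)
    := (a :* a :+ b :* b) :* (c :* c :+ d :* d)) refl a b c d

  0≤normSq : ∀ z → 0ℚ ≤ normSq z
  0≤normSq (a ⊹ b) = 0≤+0≤ (0≤p² a) (0≤p² b)

  infix 9 _⁻¹
  -- Conjugate over squared norm, with the same total `inv` that underlies complex division: at each
  -- index, dividing complex numbers is multiplication by this inverse definitionally.
  _⁻¹ : 𝔾 → 𝔾
  (a ⊹ b) ⁻¹ = (a ℚ.* i) ⊹ ((ℚ.- b) ℚ.* i)
    where i = inv (a ℚ.* a ℚ.+ b ℚ.* b)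

  *-inverseʳ : ∀ z → 0ℚ < normSq z → z * z ⁻¹ ≡ 1#
  *-inverseʳ (a ⊹ b) 0<n = cong₂ _⊹_
    (trans (solve 3 (λ a b i → a :* (a :* i) :- b :* ((:- b) :* i) := (a :* a :+ b :* b) :* i) refl a b i)
           (*-inv 0<n))
    (solve 3 (λ a b i → a :* ((:- b) :* i) :+ b :* (a :* i) := con 0ℚ) refl a b i)
    where i = inv (a ℚ.* a ℚ.+ b ℚ.* b)

  ⁻¹-unique : ∀ z w → 0ℚ < normSq z → z * w ≡ 1# → z ⁻¹ ≡ w
  ⁻¹-unique z w 0<n zw≡1 = begin
    z ⁻¹                ≡⟨ *-identityʳ _ ⟨
    z ⁻¹ * 1#           ≡⟨ cong (z ⁻¹ *_) zw≡1 ⟨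
    z ⁻¹ * (z * w)      ≡⟨ S.solve 3 (λ z w v → v S.:* (z S.:* w) S.:= (z S.:* v) S.:* w) refl z w (z ⁻¹) ⟩
    z * z ⁻¹ * w        ≡⟨ cong (_* w) (*-inverseʳ z 0<n) ⟩
    1# * w              ≡⟨ *-identityˡ w ⟩
    w                   ∎
    where
    module S = Solver
    open ≡-Reasoning

  open ℚ.≤-Reasoning

  -- |z| ≤ s
  infix 4 _⊑_
  record _⊑_ (z : 𝔾) (s : ℚ) : Set where
    constructor _,_
    field
      0≤bound  : 0ℚ ≤ s
      normSq≤  : normSq z ≤ s ℚ.* s

  open _⊑_ public

  Re² : ∀ z → Re z ℚ.* Re z ≤ normSq z
  Re² (a ⊹ b) = p≤p+q (a ℚ.* a) (0≤p² b)

  Im² : ∀ z → Im z ℚ.* Im z ≤ normSq z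
  Im² (a ⊹ b) = subst (b ℚ.* b ≤_) (ℚ.+-comm (b ℚ.* b) (a ℚ.* a)) (p≤p+q (b ℚ.* b) (0≤p² a))

  ∣Re∣≤ : ∀ {z s} → z ⊑ s → ℚ.∣ Re z ∣ ≤ s
  ∣Re∣≤ {z} (0≤s , n) = ∣∣-≤ 0≤s (ℚ.≤-trans (Re² z) n)

  ∣Im∣≤ : ∀ {z s} → z ⊑ s → ℚ.∣ Im z ∣ ≤ s
  ∣Im∣≤ {z} (0≤s , n) = ∣∣-≤ 0≤s (ℚ.≤-trans (Im² z) n)

  ⊑-mono : ∀ {z s t} → s ≤ t → z ⊑ s → z ⊑ t
  ⊑-mono {z} {s} {t} s≤t (0≤s , n) = 0≤t , ℚ.≤-trans n (*-mono-≤ 0≤s 0≤t s≤t s≤t)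
    where 0≤t = ℚ.≤-trans 0≤s s≤t

  ⊑-1 : 1# ⊑ 1ℚ
  ⊑-1 = 0≤1 , ℚ.≤-refl

  ⊑-0 : 0# ⊑ 0ℚ
  ⊑-0 = ℚ.≤-refl , ℚ.≤-refl

  ⊑-* : ∀ {z w s t} → z ⊑ s → w ⊑ t → z * w ⊑ s ℚ.* t
  ⊑-* {z} {w} {s} {t} (0≤s , n) (0≤t , m) = 0≤*0≤ 0≤s 0≤t , (begin
    normSq (z * w)                ≡⟨ normSq-* z w ⟩
    normSq z ℚ.* normSq w         ≤⟨ *-mono-≤ (0≤normSq z) (0≤*0≤ 0≤t 0≤t) n m ⟩
    s ℚ.* s ℚ.* (t ℚ.* t)         ≡⟨ solve 2 (λ s t → s :* s :* (t :* t) := s :* t :* (s :* t)) refl s t ⟩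
    s ℚ.* t ℚ.* (s ℚ.* t)         ∎)

  ⊑-neg : ∀ {z s} → z ⊑ s → - z ⊑ s
  ⊑-neg {a ⊹ b} {s} (0≤s , n) = 0≤s , subst (_≤ s ℚ.* s)
    (solve 2 (λ a b → a :* a :+ b :* b := (:- a) :* (:- a) :+ (:- b) :* (:- b)) refl a b) n

  -- Cauchy-Schwarz, from Lagrange's identity (ac+bd)² + (ad-bc)² = (a²+b²)(c²+d²) by dropping the
  -- second square.
  dot-≤ : ∀ {a b c d s t} → (a ⊹ b) ⊑ s → (c ⊹ d) ⊑ t → a ℚ.* c ℚ.+ b ℚ.* d ≤ s ℚ.* t
  dot-≤ {a} {b} {c} {d} {s} {t} (0≤s , n) (0≤t , m) = square-cancel-≤ (0≤*0≤ 0≤s 0≤t) (begin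
    p ℚ.* p                                                     ≤⟨ p≤p+q (p ℚ.* p) (0≤p² q) ⟩
    p ℚ.* p ℚ.+ q ℚ.* q                                         ≡⟨ solve 4 (λ a b c d →
      (a :* c :+ b :* d) :* (a :* c :+ b :* d) :+ (a :* d :- b :* c) :* (a :* d :- b :* c)
      := (a :* a :+ b :* b) :* (c :* c :+ d :* d)) refl a b c d ⟩
    (a ℚ.* a ℚ.+ b ℚ.* b) ℚ.* (c ℚ.* c ℚ.+ d ℚ.* d)             ≤⟨ *-mono-≤ (0≤normSq (a ⊹ b)) (0≤*0≤ 0≤t 0≤t) n m ⟩
    s ℚ.* s ℚ.* (t ℚ.* t)         ≡⟨ solve 2 (λ s t → s :* s :* (t :* t) := s :* t :* (s :* t)) refl s t ⟩
    s ℚ.* t ℚ.* (s ℚ.* t)         ∎)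
    where
    p = a ℚ.* c ℚ.+ b ℚ.* d
    q = a ℚ.* d ℚ.- b ℚ.* c

  ⊑-+ : ∀ {z w s t} → z ⊑ s → w ⊑ t → z + w ⊑ s ℚ.+ t
  ⊑-+ {a ⊹ b} {c ⊹ d} {s} {t} z⊑s@(0≤s , n) w⊑t@(0≤t , m) = 0≤+0≤ 0≤s 0≤t , (begin
    (a ℚ.+ c) ℚ.* (a ℚ.+ c) ℚ.+ (b ℚ.+ d) ℚ.* (b ℚ.+ d)   ≡⟨ solve 4 (λ a b c d →
      (a :+ c) :* (a :+ c) :+ (b :+ d) :* (b :+ d)
      := (a :* a :+ b :* b) :+ ((a :* c :+ b :* d) :+ (a :* c :+ b :* d)) :+ (c :* c :+ d :* d)) refl a b c d ⟩
    (a ℚ.* a ℚ.+ b ℚ.* b) ℚ.+ (p ℚ.+ p) ℚ.+ (c ℚ.* c ℚ.+ d ℚ.* d)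
      ≤⟨ ℚ.+-mono-≤ (ℚ.+-mono-≤ n (ℚ.+-mono-≤ (dot-≤ z⊑s w⊑t) (dot-≤ z⊑s w⊑t))) m ⟩
    s ℚ.* s ℚ.+ (s ℚ.* t ℚ.+ s ℚ.* t) ℚ.+ t ℚ.* t
      ≡⟨ solve 2 (λ s t → s :* s :+ (s :* t :+ s :* t) :+ t :* t := (s :+ t) :* (s :+ t)) refl s t ⟩
    (s ℚ.+ t) ℚ.* (s ℚ.+ t) ∎)
    where p = a ℚ.* c ℚ.+ b ℚ.* d

  ⊑-^ : ∀ {z s} → z ⊑ s → ∀ n → z ^ n ⊑ s ^ℚ n
  ⊑-^ z⊑s zero    = ⊑-1
  ⊑-^ z⊑s (suc n) = ⊑-* z⊑s (⊑-^ z⊑s n)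

  ⊑-inverse : ∀ {z w c d} → z * w ≡ 1# → c ℚ.* c ≤ normSq z → c ℚ.* d ≡ 1ℚ → 0ℚ ≤ d → w ⊑ d
  ⊑-inverse {z} {w} {c} {d} zw≡1 c²≤n cd≡1 0≤d = 0≤d , (begin
    normSq w                                ≡⟨ ℚ.*-identityʳ _ ⟨
    normSq w ℚ.* (1ℚ ℚ.* 1ℚ)                ≡⟨ cong (λ e → normSq w ℚ.* (e ℚ.* e)) cd≡1 ⟨
    normSq w ℚ.* (c ℚ.* d ℚ.* (c ℚ.* d))    ≡⟨ solve 3 (λ n c d → n :* (c :* d :* (c :* d)) := c :* c :* n :* (d :* d)) refl (normSq w) c d ⟩
    c ℚ.* c ℚ.* normSq w ℚ.* (d ℚ.* d)      ≤⟨ ℚ.*-monoʳ-≤-nonNeg (d ℚ.* d) ⦃ nonNegative (0≤*0≤ 0≤d 0≤d) ⦄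
                                                 (ℚ.*-monoʳ-≤-nonNeg (normSq w) ⦃ nonNegative (0≤normSq w) ⦄ c²≤n) ⟩
    normSq z ℚ.* normSq w ℚ.* (d ℚ.* d)     ≡⟨ cong (ℚ._* (d ℚ.* d)) (trans (sym (normSq-* z w)) (cong normSq zw≡1)) ⟩
    1ℚ ℚ.* (d ℚ.* d)                        ≡⟨ ℚ.*-identityˡ _ ⟩
    d ℚ.* d                                 ∎)

  -- Since |z| |w| = 1, an upper bound for the inverses keeps |z| away from 0. This turns
  -- boundedness of a reciprocal product into nonvanishing of the product. The constant is 1/(C+1)²,
  -- with C + 1 because C may be 0.
  normSq-inverse-≥ : ∀ {C} → 0ℚ ≤ C →
    ∃ λ δ → 0ℚ < δ × (∀ {z w} → z * w ≡ 1# → w ⊑ C → δ ≤ normSq z)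
  normSq-inverse-≥ {C} 0≤C = go (1/ (ℚ.+-mono-≤-< 0≤C 0<1))
    where
    d = C ℚ.+ 1ℚ
    bound : ∀ {c z w} → d ℚ.* c ≡ 1ℚ → z * w ≡ 1# → w ⊑ C → c ℚ.* c ≤ normSq z
    bound {c} {z} {w} dc≡1 zw≡1 w⊑C = begin
      c ℚ.* c                                     ≡⟨ ℚ.*-identityʳ _ ⟨
      c ℚ.* c ℚ.* 1ℚ                              ≡⟨ cong (c ℚ.* c ℚ.*_) (trans (sym (cong normSq zw≡1)) (normSq-* z w)) ⟩
      c ℚ.* c ℚ.* (normSq z ℚ.* normSq w)         ≤⟨ ℚ.*-monoˡ-≤-nonNeg (c ℚ.* c) ⦃ nonNegative (0≤p² c) ⦄
                                                       (ℚ.*-monoˡ-≤-nonNeg (normSq z) ⦃ nonNegative (0≤normSq z) ⦄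
                                                         (normSq≤ (⊑-mono (p≤p+q C 0≤1) w⊑C))) ⟩
      c ℚ.* c ℚ.* (normSq z ℚ.* (d ℚ.* d))        ≡⟨ solve 3 (λ n c d → c :* c :* (n :* (d :* d)) := n :* (d :* c :* (d :* c))) refl (normSq z) c d ⟩
      normSq z ℚ.* (d ℚ.* c ℚ.* (d ℚ.* c))        ≡⟨ cong (λ e → normSq z ℚ.* (e ℚ.* e)) dc≡1 ⟩
      normSq z ℚ.* (1ℚ ℚ.* 1ℚ)                    ≡⟨ ℚ.*-identityʳ _ ⟩
      normSq z                                    ∎
    go : (∃ λ c → 0ℚ < c × d ℚ.* c ≡ 1ℚ) →
      ∃ λ δ → 0ℚ < δ × (∀ {z w} → z * w ≡ 1# → w ⊑ C → δ ≤ normSq z)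
    go (c , 0<c , dc≡1) = c ℚ.* c , 0<*0< 0<c 0<c , bound dc≡1

  -- The real part suffices: Re (1 - z) ≥ 1 - s, and s ≤ 1 allows both sides to be squared.
  normSq-1- : ∀ {z s} → z ⊑ s → s ≤ 1ℚ → (1ℚ ℚ.- s) ℚ.* (1ℚ ℚ.- s) ≤ normSq (1# - z)
  normSq-1- {a ⊹ b} {s} z⊑s s≤1 = ℚ.≤-trans
    (*-mono-≤ (≤⇒0≤- s≤1) (ℚ.≤-trans (≤⇒0≤- s≤1) 1-s≤1-a) 1-s≤1-a 1-s≤1-a)
    (Re² (1# - (a ⊹ b)))
    where
    1-s≤1-a : 1ℚ ℚ.- s ≤ 1ℚ ℚ.- a
    1-s≤1-a = ℚ.+-monoʳ-≤ 1ℚ (ℚ.neg-antimono-≤ (ℚ.≤-trans (p≤∣p∣ a) (∣Re∣≤ z⊑s)))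

-- Bounds and decay rates that are uniform over the disc of radius r.

module Uniform {r : ℚ} (0≤r : 0ℚ ≤ r) (r<1 : r < 1ℚ) where
  open Rationals using () renaming (_^_ to _^ℚ_)
  open Rationals.Geometric 0≤r r<1
  open Gaussian
  open Norm

  -- The first argument stands for a rational approximation of q, which changes with the index of
  -- the approximation; hence the constants below precede the quantifier over `x`.
  Family : Set
  Family = 𝔾 → ℕ → 𝔾

  record Bounded (f : Family) : Set where
    constructor _,_
    field
      const : ℚ
      bound : ∀ x → x ⊑ r → ∀ n → f x n ⊑ const

  record Small (f : Family) : Set where
    constructor _,_
    field
      const : ℚ
      bound : ∀ x → x ⊑ r → ∀ n → f x n ⊑ const ℚ.* r ^ℚ n

  0⊑r : 0# ⊑ r
  0⊑r = ⊑-mono 0≤r ⊑-0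

  bounded-const≥0 : ∀ {f} (p : Bounded f) → 0ℚ ≤ Bounded.const p
  bounded-const≥0 (C , p) = 0≤bound (p 0# 0⊑r 0)

  small-const≥0 : ∀ {f} (p : Small f) → 0ℚ ≤ Small.const p
  small-const≥0 (C , p) = subst (0ℚ ≤_) (ℚ.*-identityʳ C) (0≤bound (p 0# 0⊑r 0))

  bounded-+ : ∀ {f g} → Bounded f → Bounded g → Bounded (λ x n → f x n + g x n)
  bounded-+ (C , p) (D , q) = C ℚ.+ D , λ x x⊑r n → ⊑-+ (p x x⊑r n) (q x x⊑r n)

  bounded-* : ∀ {f g} → Bounded f → Bounded g → Bounded (λ x n → f x n * g x n)
  bounded-* (C , p) (D , q) = C ℚ.* D , λ x x⊑r n → ⊑-* (p x x⊑r n) (q x x⊑r n)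

  bounded-neg : ∀ {f} → Bounded f → Bounded (λ x n → - f x n)
  bounded-neg (C , p) = C , λ x x⊑r n → ⊑-neg (p x x⊑r n)

  bounded-0 : Bounded (λ x n → 0#)
  bounded-0 = 0ℚ , λ x x⊑r n → ⊑-0

  bounded-1 : Bounded (λ x n → 1#)
  bounded-1 = 1ℚ , λ x x⊑r n → ⊑-1

  bounded-2 : Bounded (λ x n → 2#)
  bounded-2 = bounded-+ bounded-1 bounded-1

  bounded-power : ∀ (e : ℕ → ℕ) → Bounded (λ x n → x ^ e n)
  bounded-power e = 1ℚ , λ x x⊑r n → ⊑-mono (^≤1 (e n)) (⊑-^ x⊑r (e n))

  bounded-resp : ∀ {f g} → Bounded f → (∀ x → x ⊑ r → ∀ n → f x n ≡ g x n) → Bounded g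
  bounded-resp (C , p) eq = C , λ x x⊑r n → subst (_⊑ C) (eq x x⊑r n) (p x x⊑r n)

  bounded-index : ∀ {f} (k : ℕ → ℕ) → Bounded f → Bounded (λ x n → f x (k n))
  bounded-index k (C , p) = C , λ x x⊑r n → p x x⊑r (k n)

  small-resp : ∀ {f g} → Small f → (∀ x → x ⊑ r → ∀ n → f x n ≡ g x n) → Small g
  small-resp (C , p) eq = C , λ x x⊑r n → subst (_⊑ C ℚ.* r ^ℚ n) (eq x x⊑r n) (p x x⊑r n)

  small-+ : ∀ {f g} → Small f → Small g → Small (λ x n → f x n + g x n)
  small-+ (C , p) (D , q) = C ℚ.+ D , λ x x⊑r n →
    subst (_ ⊑_) (sym (ℚ.*-distribʳ-+ (r ^ℚ n) C D)) (⊑-+ (p x x⊑r n) (q x x⊑r n))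

  small-neg : ∀ {f} → Small f → Small (λ x n → - f x n)
  small-neg (C , p) = C , λ x x⊑r n → ⊑-neg (p x x⊑r n)

  small-* : ∀ {f g} → Bounded f → Small g → Small (λ x n → f x n * g x n)
  small-* (C , p) (D , q) = C ℚ.* D , λ x x⊑r n →
    subst (_ ⊑_) (sym (ℚ.*-assoc C D (r ^ℚ n))) (⊑-* (p x x⊑r n) (q x x⊑r n))

  small-*ʳ : ∀ {f g} → Small f → Bounded g → Small (λ x n → f x n * g x n)
  small-*ʳ {f} {g} p q = small-resp (small-* q p) (λ x x⊑r n → *-comm (g x n) (f x n))

  small-0 : Small (λ x n → 0#)
  small-0 = 0ℚ , λ x x⊑r n → subst (0# ⊑_) (sym (ℚ.*-zeroˡ (r ^ℚ n))) ⊑-0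

  small-power : ∀ (e : ℕ → ℕ) → (∀ n → n ℕ.≤ e n) → Small (λ x n → x ^ e n)
  small-power e n≤e = 1ℚ , λ x x⊑r n → subst (x ^ e n ⊑_) (sym (ℚ.*-identityˡ (r ^ℚ n)))
    (⊑-mono (^-antimono (n≤e n)) (⊑-^ x⊑r (e n)))

  small-suc : ∀ {f} → Small f → Small (λ x n → f x (suc n))
  small-suc {f} (C , p) = C , λ x x⊑r n → ⊑-mono
    (ℚ.*-monoˡ-≤-nonNeg C ⦃ nonNegative (small-const≥0 (C , p)) ⦄ (^-suc-≤ n)) (p x x⊑r (suc n))

  -- With factors 1 + O(r^n), each partial product is dominated by the matching `geoProd`, whose
  -- bound does not depend on `x`.
  product-bounded : ∀ f {e} → Small e → (∀ x → f x 0 ≡ 1#) →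
    (∀ x → x ⊑ r → ∀ n → f x (suc n) ≡ f x n * (1# + e x n)) → Bounded f
  product-bounded f small@(K , p) f0 fsuc =
    let C , geoProd≤C = geoProd-bounded K (small-const≥0 small)
    in C , λ x x⊑r n → ⊑-mono (geoProd≤C n) (go x x⊑r n)
    where
    go : ∀ x → x ⊑ r → ∀ n → f x n ⊑ geoProd K n
    go x x⊑r zero    = subst (_⊑ 1ℚ) (sym (f0 x)) ⊑-1
    go x x⊑r (suc n) = subst (_⊑ _) (sym (fsuc x x⊑r n)) (⊑-* (go x x⊑r n) (⊑-+ ⊑-1 (p x x⊑r n)))

  UniformlyCauchy : Family → Set
  UniformlyCauchy f = ∃ λ C → 0ℚ ≤ C × ∀ x → x ⊑ r → ∀ {m n} → m ℕ.≤ n → f x n - f x m ⊑ C ℚ.* r ^ℚ m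

  -- Increments of size K r^i telescope: from index m on they add up to at most K r^m times the full
  -- geometric sum `g`.
  uniformlyCauchy : ∀ f → Small (λ x n → f x (suc n) - f x n) → UniformlyCauchy f
  uniformlyCauchy f small@(K , p) = K ℚ.* g , 0≤*0≤ 0≤K 0≤g , λ x x⊑r {m} {n} m≤n →
    subst (λ n → f x n - f x m ⊑ K ℚ.* g ℚ.* r ^ℚ m) (ℕ.m+[n∸m]≡n m≤n)
      (⊑-mono (bound m (n ∸ m)) (go x x⊑r m (n ∸ m)))
    where
    0≤K = small-const≥0 small
    bound : ∀ m j → K ℚ.* r ^ℚ m ℚ.* geo j ≤ K ℚ.* g ℚ.* r ^ℚ m
    bound m j = ℚ.≤-trans
      (ℚ.*-monoˡ-≤-nonNeg (K ℚ.* r ^ℚ m) ⦃ nonNegative (0≤*0≤ 0≤K (0≤^ m)) ⦄ (geo≤g j))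
      (ℚ.≤-reflexive (solve 3 (λ k g p → k :* p :* g := k :* g :* p) refl K g (r ^ℚ m)))
      where open +-*-Solver
    go : ∀ x → x ⊑ r → ∀ m j → f x (m ℕ.+ j) - f x m ⊑ K ℚ.* r ^ℚ m ℚ.* geo j
    go x x⊑r m zero rewrite ℕ.+-identityʳ m =
      subst₂ _⊑_ (Solver.solve 1 (λ a → Solver.con 0ℚ Solver.:= a Solver.:- a) refl (f x m))
        (sym (ℚ.*-zeroʳ (K ℚ.* r ^ℚ m))) ⊑-0
    go x x⊑r m (suc j) rewrite ℕ.+-suc m j = subst₂ _⊑_
      (Solver.solve 3 (λ a b c → (b Solver.:- a) Solver.:+ (c Solver.:- b) Solver.:= c Solver.:- a) refl
        (f x m) (f x (m ℕ.+ j)) (f x (suc (m ℕ.+ j))))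
      (trans (cong (λ e → K ℚ.* r ^ℚ m ℚ.* geo j ℚ.+ K ℚ.* e) (^ℚ-homo-* r m j))
        (solve 4 (λ k p s t → k :* p :* s :+ k :* (p :* t) := k :* p :* (s :+ t)) refl K (r ^ℚ m) (geo j) (r ^ℚ j)))
      (⊑-+ (go x x⊑r m j) (p x x⊑r (m ℕ.+ j)))
      where
      open +-*-Solver
      open Rationals using () renaming (^-homo-* to ^ℚ-homo-*)

-- Exact identities between finite sums, with `u j` standing for 1/(1 - x^(j+1)).

module Terms (x : 𝔾) (u : ℕ → 𝔾) where
  open Gaussian

  R : ℕ → 𝔾
  R zero    = 1#
  R (suc n) = R n * (1# + x ^ suc n) * u n

  -- The telescoped form is taken as the definition, because it makes the difference from R_M
  -- visibly small; `G-zero` and `G-suc` identify it with the sum over m.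
  G : ℕ → ℕ → 𝔾
  G zero    M = R M * (1# - x ^ M)
  G (suc k) M = G k M + R (suc k) * R M * (x ^ suc k) ^ M * (1# - x ^ M)

  -- The term n = k + 1 + i after (-1;x)_(i+1) = 2 (-x;x)_i and after (x;x)_(n-1) has cancelled;
  -- `u (k + i)` is the factor 1/(1 - x^n) that is left.
  Y : ℕ → ℕ → 𝔾
  Y k i = 2# * R k * R i * x ^ (suc k ℕ.* suc (k ℕ.+ i)) * u (k ℕ.+ i)

  S : ℕ → ℕ → 𝔾
  S k zero    = 0#
  S k (suc M) = S k M + Y k M

module Identities (x : 𝔾) (u : ℕ → 𝔾)
  (u-inverse : ∀ j → Gaussian._*_ (Gaussian._-_ Gaussian.1# (Gaussian._^_ x (suc j))) (u j) ≡ Gaussian.1#) where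
  open Gaussian
  open Terms x u
  open Solver
  open ≡-Reasoning
  open import Algebra.Bundles using (module CommutativeRing)
  open import Algebra.Properties.CommutativeSemiring.Exp
    (CommutativeRing.commutativeSemiring commutativeRing) using (^-distrib-*)

  private
    :1 : ∀ {n} → Polynomial n
    :1 = con 1ℚ
    :2 : ∀ {n} → Polynomial n
    :2 = :1 :+ :1

  R-suc : ∀ n → R (suc n) * (1# - x ^ suc n) ≡ R n * (1# + x ^ suc n)
  R-suc n = begin
    R n * (1# + a) * u n * (1# - a)       ≡⟨ solve 3 (λ p a u → p :* (:1 :+ a) :* u :* (:1 :- a) := p :* (:1 :+ a) :* ((:1 :- a) :* u)) refl (R n) a (u n) ⟩
    R n * (1# + a) * ((1# - a) * u n)     ≡⟨ cong (R n * (1# + a) *_) (u-inverse n) ⟩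
    R n * (1# + a) * 1#                   ≡⟨ *-identityʳ _ ⟩
    R n * (1# + a)                        ∎
    where a = x ^ suc n

  R-diff : ∀ n → R (suc n) - R n ≡ 2# * R n * u n * x ^ suc n
  R-diff n = begin
    R (suc n) - R n                       ≡⟨ solve 2 (λ p q → p :- q := p :- q :* :1) refl (R (suc n)) (R n) ⟩
    R (suc n) - R n * 1#                  ≡⟨ cong (λ i → R (suc n) - R n * i) (u-inverse n) ⟨
    R n * (1# + a) * u n - R n * ((1# - a) * u n)
      ≡⟨ solve 3 (λ p a u → p :* (:1 :+ a) :* u :- p :* ((:1 :- a) :* u) := :2 :* p :* u :* a) refl (R n) a (u n) ⟩
    2# * R n * u n * a                    ∎
    where a = x ^ suc n

  G-zero : ∀ k → G k 0 ≡ 0#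
  G-zero zero    = solve 0 (:1 :* (:1 :- :1) := con 0ℚ) refl
  G-zero (suc k) = trans (cong (_+ R (suc k) * 1# * 1# * (1# - 1#)) (G-zero k))
    (solve 1 (λ p → con 0ℚ :+ p :* :1 :* :1 :* (:1 :- :1) := con 0ℚ) refl (R (suc k)))

  -- In the step on k, `R-suc` trades R_k (1 + x^(k+1)) for R_(k+1) (1 - x^(k+1)) and R_(M+1) (1 -
  -- x^(M+1)) for R_M (1 + x^(M+1)). Then R_(k+1) and R_M are the only values of R left, and the
  -- claim is a polynomial identity.
  G-suc : ∀ k M → G k (suc M) ≡ G k M + R k * (1# + x ^ suc k) * R M * (x ^ suc k) ^ M
  G-suc zero M = begin
    R (suc M) * (1# - x * x ^ M)            ≡⟨ R-suc M ⟩
    R M * (1# + x * x ^ M)                  ≡⟨ solve 3 (λ p x b → p :* (:1 :+ x :* b) :=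
                                                 p :* (:1 :- b) :+ :1 :* (:1 :+ x :* :1) :* p :* b) refl (R M) x (x ^ M) ⟩
    R M * (1# - x ^ M) + 1# * (1# + x * 1#) * R M * x ^ M
      ≡⟨ cong (λ y → R M * (1# - x ^ M) + 1# * (1# + x * 1#) * R M * y ^ M) (*-identityʳ x) ⟨
    R M * (1# - x ^ M) + 1# * (1# + x * 1#) * R M * (x * 1#) ^ M  ∎
  G-suc (suc k) M = begin
    G k (suc M) + R (suc k) * R (suc M) * (a * c) * (1# - x * b)
      ≡⟨ cong (_+ R (suc k) * R (suc M) * (a * c) * (1# - x * b)) (G-suc k M) ⟩
    G k M + R k * (1# + a) * R M * c + R (suc k) * R (suc M) * (a * c) * (1# - x * b)
      ≡⟨ solve 9 (λ g p q s t a b c x →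
           g :+ p :* (:1 :+ a) :* s :* c :+ q :* t :* (a :* c) :* (:1 :- x :* b)
           := g :+ (p :* (:1 :+ a)) :* (s :* c) :+ (t :* (:1 :- x :* b)) :* (q :* (a :* c)))
           refl (G k M) (R k) (R (suc k)) (R M) (R (suc M)) a b c x ⟩
    G k M + (R k * (1# + a)) * (R M * c) + (R (suc M) * (1# - x * b)) * (R (suc k) * (a * c))
      ≡⟨ cong₂ (λ p t → G k M + p * (R M * c) + t * (R (suc k) * (a * c))) (sym (R-suc k)) (R-suc M) ⟩
    G k M + (R (suc k) * (1# - a)) * (R M * c) + (R M * (1# + x * b)) * (R (suc k) * (a * c))
      ≡⟨ solve 7 (λ g q s a b c x →
           g :+ (q :* (:1 :- a)) :* (s :* c) :+ (s :* (:1 :+ x :* b)) :* (q :* (a :* c))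
           := g :+ q :* s :* c :* (:1 :- b) :+ q :* (:1 :+ x :* a) :* s :* (b :* c))
           refl (G k M) (R (suc k)) (R M) a b c x ⟩
    G (suc k) M + R (suc k) * (1# + x * a) * R M * (b * c)
      ≡⟨ cong (λ y → G (suc k) M + R (suc k) * (1# + x * a) * R M * y) (^-distrib-* x a M) ⟨
    G (suc k) M + R (suc k) * (1# + x * a) * R M * (x * a) ^ M  ∎
    where
    a = x ^ suc k
    b = x ^ M
    c = (x ^ suc k) ^ M

  -- For k = 0 each term is an increment of R, so the sum telescopes and the induction on k starts
  -- without any error.
  S-zero : ∀ M → S 0 M ≡ R M - 1#
  S-zero zero    = solve 0 (con 0ℚ := :1 :- :1) refl
  S-zero (suc M) = begin
    S 0 M + Y 0 M                                   ≡⟨ cong₂ _+_ (S-zero M) Y0 ⟩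
    R M - 1# + (R (suc M) - R M)                    ≡⟨ solve 2 (λ p q → p :- :1 :+ (q :- p) := q :- :1) refl (R M) (R (suc M)) ⟩
    R (suc M) - 1#                                  ∎
    where
    Y0 : Y 0 M ≡ R (suc M) - R M
    Y0 = begin
      2# * 1# * R M * x ^ (suc M ℕ.+ 0) * u M   ≡⟨ cong (λ e → 2# * 1# * R M * x ^ e * u M) (ℕ.+-identityʳ (suc M)) ⟩
      2# * 1# * R M * x ^ suc M * u M           ≡⟨ solve 3 (λ p a u → :2 :* :1 :* p :* a :* u := :2 :* p :* u :* a) refl (R M) (x ^ suc M) (u M) ⟩
      2# * R M * u M * x ^ suc M                ≡⟨ R-diff M ⟨
      R (suc M) - R M                           ∎

  -- Over the common denominator (1-a)(1-b), the bracket has numerator (1-ab)(1+ab+b-a), so `w`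
  -- cancels.
  partial-fractions : ∀ {a b s t w} → (1# - a) * s ≡ 1# → (1# - b) * t ≡ 1# → (1# - a * b) * w ≡ 1# →
    a * w * ((1# + a) * s * (a * b) + (1# + b) * t) ≡ (1# + a) + s * ((1# + b) * t * a - 1#)
  partial-fractions {a} {b} {s} {t} {w} hs ht hw = begin
    a * w * ((1# + a) * s * (a * b) + (1# + b) * t)
      ≡⟨ solve 5 (λ a b s t w → a :* w :* ((:1 :+ a) :* s :* (a :* b) :+ (:1 :+ b) :* t)
           := a :* w :* ((:1 :+ a) :* s :* (a :* b) :* :1 :+ (:1 :+ b) :* t :* :1)) refl a b s t w ⟩
    a * w * ((1# + a) * s * (a * b) * 1# + (1# + b) * t * 1#)
      ≡⟨ cong₂ (λ i j → a * w * ((1# + a) * s * (a * b) * i + (1# + b) * t * j)) ht hs ⟨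
    a * w * ((1# + a) * s * (a * b) * ((1# - b) * t) + (1# + b) * t * ((1# - a) * s))
      ≡⟨ solve 5 (λ a b s t w →
           a :* w :* ((:1 :+ a) :* s :* (a :* b) :* ((:1 :- b) :* t) :+ (:1 :+ b) :* t :* ((:1 :- a) :* s))
           := a :* s :* t :* (:1 :+ a :* b :+ b :- a) :* ((:1 :- a :* b) :* w)) refl a b s t w ⟩
    a * s * t * (1# + a * b + b - a) * ((1# - a * b) * w)
      ≡⟨ cong (a * s * t * (1# + a * b + b - a) *_) hw ⟩
    a * s * t * (1# + a * b + b - a) * 1#
      ≡⟨ solve 4 (λ a b s t → a :* s :* t :* (:1 :+ a :* b :+ b :- a) :* :1
           := (:1 :+ a) :* ((:1 :- a) :* s) :* ((:1 :- b) :* t) :+ s :* ((:1 :+ b) :* t :* a :- (:1 :- b) :* t)) refl a b s t ⟩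
    (1# + a) * ((1# - a) * s) * ((1# - b) * t) + s * ((1# + b) * t * a - (1# - b) * t)
      ≡⟨ cong₂ (λ i j → (1# + a) * i * j + s * ((1# + b) * t * a - j)) hs ht ⟩
    (1# + a) * 1# * 1# + s * ((1# + b) * t * a - 1#)
      ≡⟨ solve 4 (λ a b s t → (:1 :+ a) :* :1 :* :1 :+ s :* ((:1 :+ b) :* t :* a :- :1)
           := (:1 :+ a) :+ s :* ((:1 :+ b) :* t :* a :- :1)) refl a b s t ⟩
    (1# + a) + s * ((1# + b) * t * a - 1#) ∎

  -- Induction on M: of the right-hand side of `partial-fractions`, the part 1 + a yields the
  -- increment of G and the rest yields that of the boundary term R_k R_M x^((k+1)M) / (1 -
  -- x^(k+1)). For M = 0 the left-hand side is the first term of S k alone, and G vanishes.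
  S-recurrence : ∀ k M → S (suc k) M + S k (suc M) ≡
    2# * x ^ (suc k ℕ.* suc k) * (G k M + R k * u k * R M * (x ^ suc k) ^ M)
  S-recurrence k zero rewrite ℕ.+-identityʳ k | G-zero k =
    solve 3 (λ p s u → con 0ℚ :+ (con 0ℚ :+ :2 :* p :* :1 :* s :* u)
                       := :2 :* s :* (con 0ℚ :+ p :* u :* :1 :* :1)) refl
      (R k) (x ^ (suc k ℕ.* suc k)) (u k)
  S-recurrence k (suc M) = begin
    S (suc k) M + Y (suc k) M + (S k (suc M) + Y k (suc M))
      ≡⟨ solve 4 (λ s y t z → s :+ y :+ (t :+ z) := s :+ t :+ (y :+ z)) refl (S (suc k) M) (Y (suc k) M) (S k (suc M)) (Y k (suc M)) ⟩
    S (suc k) M + S k (suc M) + (Y (suc k) M + Y k (suc M))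
      ≡⟨ cong₂ _+_ (S-recurrence k M) (cong₂ _+_ Y₁ Y₂) ⟩
    2# * s * (G k M + R k * u k * R M * c) +
      (2# * (R k * (1# + a) * u k) * R M * (a * b * (s * (a * c))) * w + 2# * R k * (R M * (1# + b) * u M) * (s * (a * c)) * w)
      ≡⟨ solve 10 (λ g p q a b c s w u v →
           :2 :* s :* (g :+ p :* u :* q :* c) :+
             (:2 :* (p :* (:1 :+ a) :* u) :* q :* (a :* b :* (s :* (a :* c))) :* w :+ :2 :* p :* (q :* (:1 :+ b) :* v) :* (s :* (a :* c)) :* w)
           := :2 :* s :* (g :+ p :* u :* q :* c) :+ :2 :* s :* p :* q :* c :* (a :* w :* ((:1 :+ a) :* u :* (a :* b) :+ (:1 :+ b) :* v)))
           refl (G k M) (R k) (R M) a b c s w (u k) (u M) ⟩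
    2# * s * (G k M + R k * u k * R M * c) + 2# * s * R k * R M * c * (a * w * ((1# + a) * u k * (a * b) + (1# + b) * u M))
      ≡⟨ cong (λ y → 2# * s * (G k M + R k * u k * R M * c) + 2# * s * R k * R M * c * y)
              (partial-fractions (u-inverse k) (u-inverse M) w-inverse) ⟩
    2# * s * (G k M + R k * u k * R M * c) + 2# * s * R k * R M * c * ((1# + a) + u k * ((1# + b) * u M * a - 1#))
      ≡⟨ solve 9 (λ g p q a b c s u v →
           :2 :* s :* (g :+ p :* u :* q :* c) :+ :2 :* s :* p :* q :* c :* ((:1 :+ a) :+ u :* ((:1 :+ b) :* v :* a :- :1))
           := :2 :* s :* (g :+ p :* (:1 :+ a) :* q :* c :+ p :* u :* (q :* (:1 :+ b) :* v) :* (a :* c)))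
           refl (G k M) (R k) (R M) a b c s (u k) (u M) ⟩
    2# * s * (G k M + R k * (1# + a) * R M * c + R k * u k * R (suc M) * (a * c))
      ≡⟨ cong (λ y → 2# * s * (y + R k * u k * R (suc M) * (a * c))) (G-suc k M) ⟨
    2# * s * (G k (suc M) + R k * u k * R (suc M) * (a * c)) ∎
    where
    a = x ^ suc k
    b = x ^ suc M
    c = (x ^ suc k) ^ M
    s = x ^ (suc k ℕ.* suc k)
    N = suc k ℕ.+ suc M
    w = u (suc (k ℕ.+ M))
    N≡ : suc (suc (k ℕ.+ M)) ≡ N
    N≡ = cong suc (sym (ℕ.+-suc k M))
    xᴺ : x ^ N ≡ a * b
    xᴺ = ^-homo-* x (suc k) (suc M)
    w-inverse : (1# - a * b) * w ≡ 1#
    w-inverse = trans (cong (λ y → (1# - y) * w) (trans (sym xᴺ) (cong (x ^_) (sym N≡)))) (u-inverse (suc (k ℕ.+ M)))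
    xᴸᴺ : x ^ (suc k ℕ.* N) ≡ s * (a * c)
    xᴸᴺ = begin
      x ^ (suc k ℕ.* N)                               ≡⟨ cong (x ^_) (ℕ.*-distribˡ-+ (suc k) (suc k) (suc M)) ⟩
      x ^ (suc k ℕ.* suc k ℕ.+ suc k ℕ.* suc M)       ≡⟨ ^-homo-* x (suc k ℕ.* suc k) (suc k ℕ.* suc M) ⟩
      s * x ^ (suc k ℕ.* suc M)                       ≡⟨ cong (s *_) (^-assocʳ x (suc k) (suc M)) ⟨
      s * (a * c)                                     ∎
    Y₁ : Y (suc k) M ≡ 2# * R (suc k) * R M * (a * b * (s * (a * c))) * w
    Y₁ = cong (λ y → 2# * R (suc k) * R M * y * w) (begin
      x ^ (suc (suc k) ℕ.* suc (suc k ℕ.+ M))         ≡⟨ cong (λ n → x ^ (suc (suc k) ℕ.* n)) N≡ ⟩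
      x ^ (N ℕ.+ suc k ℕ.* N)                         ≡⟨ ^-homo-* x N (suc k ℕ.* N) ⟩
      x ^ N * x ^ (suc k ℕ.* N)                       ≡⟨ cong₂ _*_ xᴺ xᴸᴺ ⟩
      a * b * (s * (a * c))                           ∎)
    Y₂ : Y k (suc M) ≡ 2# * R k * R (suc M) * (s * (a * c)) * w
    Y₂ = cong₂ (λ y z → 2# * R k * R (suc M) * y * z) xᴸᴺ (cong u (ℕ.+-suc k M))

-- Uniform estimates for the q-products, the partial sums and the error term.

qfac𝔾 : 𝔾 → 𝔾 → ℕ → 𝔾
qfac𝔾 a x zero    = Gaussian.1#
qfac𝔾 a x (suc n) = qfac𝔾 a x n * (1# - a * x ^ n)
  where open Gaussian

module QSeries {r : ℚ} (0≤r : 0ℚ ≤ r) (r<1 : r < 1ℚ) where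
  open Rationals using (<⇒0<-) renaming (_^_ to _^ℚ_)
  open Rationals.Geometric 0≤r r<1 using (r≤1; g; 0≤g; geo-total; ^-antimono)
  open Gaussian
  open Norm
  open Uniform 0≤r r<1
  open Solver
  open ≡-Reasoning

  private
    :1 : ∀ {n} → Polynomial n
    :1 = con 1ℚ
    :2 : ∀ {n} → Polynomial n
    :2 = :1 :+ :1

  u : 𝔾 → ℕ → 𝔾
  u x j = (1# - x ^ suc j) ⁻¹

  module _ (x : 𝔾) (x⊑r : x ⊑ r) where

    normSq-factor-≥ : ∀ j → (1ℚ ℚ.- r) ℚ.* (1ℚ ℚ.- r) ≤ normSq (1# - x ^ suc j)
    normSq-factor-≥ j = normSq-1- (⊑-mono r^≤r (⊑-^ x⊑r (suc j))) r≤1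
      where
      r^≤r : r ^ℚ suc j ≤ r
      r^≤r = subst (r ^ℚ suc j ≤_) (ℚ.*-identityʳ r) (^-antimono {1} {suc j} (s≤s z≤n))

    u-inverse : ∀ j → (1# - x ^ suc j) * u x j ≡ 1#
    u-inverse j = *-inverseʳ _ (ℚ.<-≤-trans (0<*0< (<⇒0<- r<1) (<⇒0<- r<1)) (normSq-factor-≥ j))

  bounded-u : Bounded u
  bounded-u = g , λ x x⊑r j → ⊑-inverse {c = 1ℚ ℚ.- r} (u-inverse x x⊑r j) (normSq-factor-≥ x x⊑r j) (proj₂ (proj₂ geo-total)) 0≤g

  -- `V` is the exact inverse of `Q`, built as a product of reciprocals so that it can be bounded
  -- like `P` and `Q`.
  P Q V R : Family
  P x = qfac𝔾 (- x) x
  Q x = qfac𝔾 x x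
  V x zero    = 1#
  V x (suc n) = V x n * u x n
  R x = Terms.R x (u x)

  Q*V : ∀ x → x ⊑ r → ∀ n → Q x n * V x n ≡ 1#
  Q*V x x⊑r zero    = *-identityˡ 1#
  Q*V x x⊑r (suc n) = begin
    Q x n * (1# - a) * (V x n * u x n)    ≡⟨ solve 4 (λ a q v u → q :* (:1 :- a) :* (v :* u) := q :* v :* ((:1 :- a) :* u)) refl a (Q x n) (V x n) (u x n) ⟩
    Q x n * V x n * ((1# - a) * u x n)    ≡⟨ cong₂ _*_ (Q*V x x⊑r n) (u-inverse x x⊑r n) ⟩
    1# * 1#                               ≡⟨ *-identityˡ 1# ⟩
    1#                                    ∎
    where a = x ^ suc n

  P*V : ∀ x n → P x n * V x n ≡ R x n
  P*V x zero    = *-identityˡ 1#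
  P*V x (suc n) = begin
    P x n * (1# - (- x) * x ^ n) * (V x n * u x n)  ≡⟨ solve 5 (λ p v u x a → p :* (:1 :- (:- x) :* a) :* (v :* u) := p :* v :* (:1 :+ x :* a) :* u) refl (P x n) (V x n) (u x n) x (x ^ n) ⟩
    P x n * V x n * (1# + x * x ^ n) * u x n        ≡⟨ cong (λ y → y * (1# + x * x ^ n) * u x n) (P*V x n) ⟩
    R x n * (1# + x * x ^ n) * u x n                ∎

  small-x^suc : Small (λ x n → x ^ suc n)
  small-x^suc = small-power suc ℕ.n≤1+n

  bounded-P : Bounded P
  bounded-P = product-bounded P small-x^suc (λ x → refl)
    (λ x x⊑r n → cong (P x n *_) (solve 2 (λ x a → :1 :- (:- x) :* a := :1 :+ x :* a) refl x (x ^ n)))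

  bounded-Q : Bounded Q
  bounded-Q = product-bounded Q (small-neg small-x^suc) (λ x → refl) (λ x x⊑r n → refl)

  -- 1/(1-a) = 1 + a/(1-a), so the reciprocal factors are again 1 + O(r^n).
  bounded-V : Bounded V
  bounded-V = product-bounded V (small-*ʳ small-x^suc bounded-u) (λ x → refl)
    (λ x x⊑r n → cong (V x n *_) (begin
      u x n                                               ≡⟨ solve 2 (λ a u → u := (:1 :- a) :* u :+ a :* u) refl (x ^ suc n) (u x n) ⟩
      (1# - x ^ suc n) * u x n + x ^ suc n * u x n        ≡⟨ cong (_+ x ^ suc n * u x n) (u-inverse x x⊑r n) ⟩
      1# + x ^ suc n * u x n                              ∎))

  bounded-R : Bounded R
  bounded-R = bounded-resp (bounded-* bounded-P bounded-V) (λ x x⊑r n → P*V x n)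

  -- One `δ` for all `x` and `n` serves every (q;q)_n and, along the diagonal, the limit (q;q)_∞
  -- too.
  normSq-Q-≥ : ∃ λ δ → 0ℚ < δ × (∀ x → x ⊑ r → ∀ n → δ ≤ normSq (Q x n))
  normSq-Q-≥ =
    let δ , 0<δ , δ≤ = normSq-inverse-≥ (bounded-const≥0 bounded-V)
    in δ , 0<δ , λ x x⊑r n → δ≤ (Q*V x x⊑r n) (Bounded.bound bounded-V x x⊑r n)

  P-cauchy : UniformlyCauchy P
  P-cauchy = uniformlyCauchy P (small-resp (small-* bounded-P small-x^suc)
    (λ x x⊑r n → solve 3 (λ p x a → p :* (x :* a) := p :* (:1 :- (:- x) :* a) :- p) refl (P x n) x (x ^ n)))

  Q-cauchy : UniformlyCauchy Q
  Q-cauchy = uniformlyCauchy Q (small-resp (small-* bounded-Q (small-neg small-x^suc))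
    (λ x x⊑r n → solve 3 (λ p x a → p :* (:- (x :* a)) := p :* (:1 :- x :* a) :- p) refl (Q x n) x (x ^ n)))

  module _ (k : ℕ) where
    G Y S : Family
    G x = Terms.G x (u x) k
    Y x = Terms.Y x (u x) k
    S x = Terms.S x (u x) k

  small-R-diff : Small (λ x n → R x (suc n) - R x n)
  small-R-diff = small-resp (small-* (bounded-* (bounded-* bounded-2 bounded-R) bounded-u) small-x^suc)
    (λ x x⊑r n → sym (Identities.R-diff x (u x) (u-inverse x x⊑r) n))

  small-Y : ∀ k → Small (Y k)
  small-Y k = small-*ʳ
    (small-* (bounded-* (bounded-* bounded-2 (bounded-index (λ _ → k) bounded-R)) bounded-R)
      (small-power (λ i → suc k ℕ.* suc (k ℕ.+ i))
        λ i → ℕ.≤-trans (ℕ.≤-trans (ℕ.m≤n+m i k) (ℕ.n≤1+n _)) (ℕ.m≤m+n (suc (k ℕ.+ i)) _)))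
    (bounded-index (k ℕ.+_) bounded-u)

  S-cauchy : ∀ k → UniformlyCauchy (S k)
  S-cauchy k = uniformlyCauchy (S k) (small-resp (small-Y k)
    (λ x x⊑r n → solve 2 (λ s y → y := s :+ y :- s) refl (S k x n) (Y k x n)))

  small-x^[1+k]^n : ∀ k → Small (λ x n → (x ^ suc k) ^ n)
  small-x^[1+k]^n k = small-resp (small-power (suc k ℕ.*_) λ n → ℕ.m≤m+n n _)
    (λ x x⊑r n → sym (^-assocʳ x (suc k) n))

  -- Each summand of the difference carries a factor x^n or a power x^(jn) with j ≥ 1.
  small-G-R : ∀ k → Small (λ x n → G k x n - R x n)
  small-G-R zero    = small-resp
    (small-neg (small-* bounded-R (small-power (λ n → n) λ n → ℕ.≤-refl)))
    (λ x x⊑r n → solve 2 (λ p a → :- (p :* a) := p :* (:1 :- a) :- p) refl (R x n) (x ^ n))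
  small-G-R (suc k) = small-resp
    (small-+ (small-G-R k) (small-*ʳ
      (small-* (bounded-* (bounded-index (λ _ → suc k) bounded-R) bounded-R) (small-x^[1+k]^n k))
      (bounded-+ bounded-1 (bounded-neg (bounded-power (λ n → n))))))
    (λ x x⊑r n → solve 3 (λ g p y → g :- p :+ y := g :+ y :- p) refl (G k x n) (R x n)
       (R x (suc k) * R x n * (x ^ suc k) ^ n * (1# - x ^ n)))

  sgn : ℕ → 𝔾
  sgn k = (- 1#) ^ k

  θ : ℕ → 𝔾 → 𝔾
  θ zero    x = 0#
  θ (suc k) x = θ k x + sgn (suc k) * x ^ (suc k ℕ.^ 2)

  sgn² : ∀ k → sgn k * sgn k ≡ 1#
  sgn² zero    = *-identityˡ 1#
  sgn² (suc k) = trans (solve 1 (λ s → (:- :1) :* s :* ((:- :1) :* s) := s :* s) refl (sgn k)) (sgn² k)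

  bounded-sgn : ∀ k → Bounded (λ x n → sgn k)
  bounded-sgn zero    = bounded-1
  bounded-sgn (suc k) = bounded-* (bounded-neg bounded-1) (bounded-sgn k)

  bounded-θ : ∀ k → Bounded (λ x n → θ k x)
  bounded-θ zero    = bounded-0
  bounded-θ (suc k) = bounded-+ (bounded-θ k) (bounded-* (bounded-sgn (suc k)) (bounded-power (λ _ → suc k ℕ.^ 2)))

  error : ℕ → Family
  error k x n = S k x n - sgn k * (R x n * (1# + 2# * θ k x) - 1#)

  -- The recurrence solved for the next error, so that every summand is small by itself. The
  -- recurrence involves `S k` at n + 1, hence the previous error at n + 1 and the correction by
  -- R_(n+1) - R_n.
  error-suc : ∀ k x → x ⊑ r → ∀ n →
    2# * x ^ (suc k ℕ.* suc k) * (G k x n - R x n)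
      + 2# * x ^ (suc k ℕ.* suc k) * R x k * u x k * R x n * (x ^ suc k) ^ n
      - error k x (suc n)
      - sgn k * (1# + 2# * θ k x) * (R x (suc n) - R x n)
    ≡ error (suc k) x n
  error-suc k x x⊑r n = begin
    2# * s * (G k x n - R x n) + 2# * s * R x k * u x k * R x n * c
      - (S k x (suc n) - e * (R x (suc n) * (1# + 2# * t) - 1#))
      - e * (1# + 2# * t) * (R x (suc n) - R x n)
      ≡⟨ solve 9 (λ s g p q q' v c S' w → 
           :2 :* s :* (g :- q) :+ :2 :* s :* p :* v :* q :* c :- (S' :- w) :- q'
           := (:2 :* s :* (g :+ p :* v :* q :* c) :- S') :+ w :- q' :- :2 :* s :* q :* :1) refl
           s (G k x n) (R x k) (R x n) (e * (1# + 2# * t) * (R x (suc n) - R x n)) (u x k) c (S k x (suc n))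
           (e * (R x (suc n) * (1# + 2# * t) - 1#)) ⟩
    (2# * s * (G k x n + R x k * u x k * R x n * c) - S k x (suc n))
      + e * (R x (suc n) * (1# + 2# * t) - 1#) - e * (1# + 2# * t) * (R x (suc n) - R x n) - 2# * s * R x n * 1#
      -- Inserting sgn² = 1 into the term 2 s R_n lets it merge with the theta sum as its next
      -- summand.
      ≡⟨ cong₂ (λ y i → y - S k x (suc n) + e * (R x (suc n) * (1# + 2# * t) - 1#)
                        - e * (1# + 2# * t) * (R x (suc n) - R x n) - 2# * s * R x n * i)
               (Identities.S-recurrence x (u x) (u-inverse x x⊑r) k n) (sgn² k) ⟨
    (S (suc k) x n + S k x (suc n) - S k x (suc n))
      + e * (R x (suc n) * (1# + 2# * t) - 1#) - e * (1# + 2# * t) * (R x (suc n) - R x n) - 2# * s * R x n * (e * e)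
      ≡⟨ solve 7 (λ S₁ S₂ e q q' t s →
           (S₁ :+ S₂ :- S₂) :+ e :* (q' :* (:1 :+ :2 :* t) :- :1) :- e :* (:1 :+ :2 :* t) :* (q' :- q) :- :2 :* s :* q :* (e :* e)
           := S₁ :- (:- :1) :* e :* (q :* (:1 :+ :2 :* (t :+ (:- :1) :* e :* s)) :- :1)) refl
           (S (suc k) x n) (S k x (suc n)) e (R x n) (R x (suc n)) t s ⟩
    S (suc k) x n - sgn (suc k) * (R x n * (1# + 2# * (t + sgn (suc k) * s)) - 1#)
      ≡⟨ cong (λ m → S (suc k) x n - sgn (suc k) * (R x n * (1# + 2# * (t + sgn (suc k) * x ^ (suc k ℕ.* m))) - 1#))
           (sym (ℕ.*-identityʳ (suc k))) ⟩
    error (suc k) x n ∎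
    where
    s = x ^ (suc k ℕ.* suc k)
    c = (x ^ suc k) ^ n
    e = sgn k
    t = θ k x

  small-error : ∀ k → Small (error k)
  small-error zero    = small-resp small-0 (λ x x⊑r n → sym (begin
      S 0 x n - 1# * (R x n * (1# + 2# * 0#) - 1#)
        ≡⟨ cong (_- 1# * (R x n * (1# + 2# * 0#) - 1#)) (Identities.S-zero x (u x) (u-inverse x x⊑r) n) ⟩
      R x n - 1# - 1# * (R x n * (1# + 2# * 0#) - 1#)
        ≡⟨ solve 1 (λ p → p :- :1 :- :1 :* (p :* (:1 :+ :2 :* con 0ℚ) :- :1) := con 0ℚ) refl (R x n) ⟩
      0# ∎))
  small-error (suc k) = small-resp
    (small-+ (small-+ (small-+
      (small-* (bounded-* bounded-2 bounded-s) (small-G-R k))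
      (small-* (bounded-* (bounded-* (bounded-* (bounded-* bounded-2 bounded-s)
        (bounded-index (λ _ → k) bounded-R)) (bounded-index (λ _ → k) bounded-u)) bounded-R) (small-x^[1+k]^n k)))
      (small-neg (small-suc (small-error k))))
      (small-neg (small-* (bounded-* (bounded-sgn k) (bounded-+ bounded-1 (bounded-* bounded-2 (bounded-θ k)))) small-R-diff)))
    (error-suc k)
    where bounded-s = bounded-power (λ _ → suc k ℕ.* suc k)

-- Passage between complex numbers and their Gaussian rational approximations.

module Evaluation where
  open Rationals using (<⇒0<-; square-cancel-≤) renaming (_^_ to _^ℚ_)
  open Approximation
  open Gaussian
  open Norm

  -- Opaque, so that comparing values of at never compares complex numbers, whose Cauchy proofs are huge.
  opaque
    at : ℂ → ℕ → 𝔾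
    at z n = seq (re z) n ⊹ seq (im z) n

    seq-normSq : ∀ z n → seq (Defs.normSq z) n ≡ normSq (at z n)
    seq-normSq z n = refl

    at-0 : ∀ n → at 0ℂ n ≡ 0#
    at-0 n = refl

    at-1 : ∀ n → at 1ℂ n ≡ 1#
    at-1 n = refl

    at-neg : ∀ z n → at (Defs.- z) n ≡ - at z n
    at-neg z n = refl

    at-^-suc : ∀ z m n → at (z Defs.^ suc m) n ≡ at z n * at (z Defs.^ m) n
    at-^-suc z m n = refl

    at-qfac-suc : ∀ a q m n → at (qfac a q (suc m)) n ≡
      at (qfac a q m) n * (1# - at a n * at (q Defs.^ m) n)
    at-qfac-suc a q m n = refl

    at-sum-suc : ∀ a N f n → at (sum a (suc N) f) n ≡ at (sum a N f) n + at (f (a ℕ.+ N)) n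
    at-sum-suc a N f n = refl

    at-- : ∀ z w n → at (z Defs.- w) n ≡ at z n - at w n
    at-- z w n = refl

    re-diff : ∀ z w n → seq (re z) n ℚ.- seq (re w) n ≡ Re (at z n - at w n)
    re-diff z w n = refl

    im-diff : ∀ z w n → seq (im z) n ℚ.- seq (im w) n ≡ Im (at z n - at w n)
    im-diff z w n = refl

  at-^ : ∀ z m n → at (z Defs.^ m) n ≡ at z n ^ m
  at-^ z zero    n = at-1 n
  at-^ z (suc m) n = trans (at-^-suc z m n) (cong (at z n *_) (at-^ z m n))

  at-qfac : ∀ a q m n → at (qfac a q m) n ≡ qfac𝔾 (at a n) (at q n) m
  at-qfac a q zero    n = at-1 n
  at-qfac a q (suc m) n = trans (at-qfac-suc a q m n)
    (cong₂ (λ p y → p * (1# - at a n * y)) (at-qfac a q m n) (at-^ q m n))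

  √≈-≤ : ∀ {a s} n → 0ℚ ≤ s → a ≤ s ℚ.* s → √≈ a n ≤ s
  √≈-≤ {a} {s} n 0≤s a≤s² with √≈ a n ℚ.≤? s
  ... | yes √a≤s = √a≤s
  ... | no  √a≰s = square-cancel-≤ 0≤s
    (ℚ.≤-trans (√≈-lower a n (ℚ.≤-<-trans 0≤s (ℚ.≰⇒> √a≰s))) a≤s²)

  ∣∣<-intro : ∀ {z ε s} → 0ℚ ≤ s → s < ε → Eventually (λ n → at z n ⊑ s) → Defs.∣ z ∣ <ᴿ fromℚ ε
  ∣∣<-intro {z} {ε} {s} 0≤s s<ε (N , z⊑s) = ε ℚ.- s , <⇒0<- s<ε , N , λ n N≤n → begin
    √≈ (seq (Defs.normSq z) n) n ℚ.+ (ε ℚ.- s)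
      ≤⟨ ℚ.+-monoˡ-≤ (ε ℚ.- s) (√≈-≤ n 0≤s (subst (_≤ s ℚ.* s) (sym (seq-normSq z n)) (normSq≤ (z⊑s n N≤n)))) ⟩
    s ℚ.+ (ε ℚ.- s)    ≡⟨ solve 2 (λ s ε → s :+ (ε :- s) := ε) refl s ε ⟩
    ε                  ∎
    where
    open ℚ.≤-Reasoning
    open +-*-Solver

  record EventuallyInDisc (z : ℂ) : Set where
    field
      {radius}  : ℚ
      0≤radius  : 0ℚ ≤ radius
      radius<1  : radius < 1ℚ
      start     : ℕ
      at⊑radius : ∀ n → start ℕ.≤ n → at z n ⊑ radius

  ∣∣<1-elim : ∀ z → Defs.∣ z ∣ <ᴿ 1ᴿ → EventuallyInDisc z
  ∣∣<1-elim z (δ , 0<δ , M , √+δ≤1) = record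
    { 0≤radius  = 0≤r
    ; radius<1  = r<1
    ; start     = M ℕ.⊔ N
    ; at⊑radius = λ n ≤n → 0≤r ,
        ℚ.<⇒≤ (subst (_< r ℚ.* r) (seq-normSq z n) (ℚ.<-≤-trans (√≈-upper (a n) n)
          (*-mono-≤ (0≤√+1/n n) 0≤r (√+1/n≤r n ≤n) (√+1/n≤r n ≤n))))
    }
    where
    open ℚ.≤-Reasoning
    open +-*-Solver
    a : ℕ → ℚ
    a n = seq (Defs.normSq z) n
    h = ½ ℚ.* δ
    0<h : 0ℚ < h
    0<h = 0<½* 0<δ
    N = proj₁ (archimedean 0<h)
    -- Half of the gap `δ` pays for the error 1/(n+1) of the approximate square root; the other half
    -- keeps `r` below 1.
    r = 1ℚ ℚ.- h
    0≤√+1/n : ∀ n → 0ℚ ≤ √≈ (a n) n ℚ.+ frac 1 n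
    0≤√+1/n n = ℚ.+-mono-≤ (0≤√≈ (a n) n) (0≤frac 1 n)
    √+1/n≤r : ∀ n → M ℕ.⊔ N ℕ.≤ n → √≈ (a n) n ℚ.+ frac 1 n ≤ r
    √+1/n≤r n ≤n = begin
      √≈ (a n) n ℚ.+ frac 1 n       ≤⟨ ℚ.+-monoʳ-≤ (√≈ (a n) n) (ℚ.<⇒≤ (proj₂ (archimedean 0<h) n (ℕ.m⊔n≤o⇒n≤o M N ≤n))) ⟩
      √≈ (a n) n ℚ.+ h              ≡⟨ solve 2 (λ s h → s :+ h := s :+ (h :+ h) :- h) refl (√≈ (a n) n) h ⟩
      √≈ (a n) n ℚ.+ (h ℚ.+ h) ℚ.- h ≡⟨ cong (λ e → √≈ (a n) n ℚ.+ e ℚ.- h) (½+½ δ) ⟩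
      √≈ (a n) n ℚ.+ δ ℚ.- h        ≤⟨ ℚ.+-monoˡ-≤ (ℚ.- h) (√+δ≤1 n (ℕ.m⊔n≤o⇒m≤o M N ≤n)) ⟩
      r                             ∎
    0≤r : 0ℚ ≤ r
    0≤r = ℚ.≤-trans (0≤√+1/n (M ℕ.⊔ N)) (√+1/n≤r (M ℕ.⊔ N) ℕ.≤-refl)
    r<1 : r < 1ℚ
    r<1 = subst (r <_) (ℚ.+-identityʳ 1ℚ) (ℚ.+-monoʳ-< 1ℚ (ℚ.neg-antimono-< 0<h))

  nonZero-intro : ∀ {z δ} → 0ℚ < δ → Eventually (λ n → δ ≤ normSq (at z n)) → NonZero z
  nonZero-intro {z} {δ} 0<δ (N , δ≤) = δ , 0<δ , N , λ n N≤n →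
    subst₂ _≤_ (sym (ℚ.+-identityˡ δ)) (sym (seq-normSq z n)) (δ≤ n N≤n)

  -- Each diagonal entry is compared at its own index with the fixed real `X K`, and the Cauchy
  -- property of `X K` bridges the two indices. The tolerance splits as ε/4 + ε/4 + ε/2.
  diagonal : (X : ℕ → ℝ) →
    (∀ {ε} → 0ℚ < ε → ∃ λ K → ∀ n → K ℕ.≤ n → ℚ.∣ seq (X n) n ℚ.- seq (X K) n ∣ < ε) → ℝ
  seq    (diagonal X close) n = seq (X n) n
  cauchy (diagonal X close) {ε} 0<ε =
    let h        = ½ ℚ.* ε
        0<h      = 0<½* 0<ε
        h′       = ½ ℚ.* h
        K , p    = close (0<½* 0<h)
        N , c    = cauchy (X K) 0<h
    in K ℕ.⊔ N , λ m n ≤m ≤n →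
      let a = seq (X m) m; b = seq (X K) m; d = seq (X K) n; e = seq (X n) n
          am = p m (ℕ.m⊔n≤o⇒m≤o K N ≤m)
          en = p n (ℕ.m⊔n≤o⇒m≤o K N ≤n)
          bd = c m n (ℕ.m⊔n≤o⇒n≤o K N ≤m) (ℕ.m⊔n≤o⇒n≤o K N ≤n)
      in begin-strict
        ℚ.∣ a ℚ.- e ∣
          ≡⟨ cong ℚ.∣_∣ (solve 4 (λ a b d e → a :- e := (a :- b) :- (e :- d) :+ (b :- d)) refl a b d e) ⟩
        ℚ.∣ (a ℚ.- b) ℚ.- (e ℚ.- d) ℚ.+ (b ℚ.- d) ∣
          ≤⟨ ℚ.∣p+q∣≤∣p∣+∣q∣ ((a ℚ.- b) ℚ.- (e ℚ.- d)) (b ℚ.- d) ⟩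
        ℚ.∣ (a ℚ.- b) ℚ.- (e ℚ.- d) ∣ ℚ.+ ℚ.∣ b ℚ.- d ∣
          ≤⟨ ℚ.+-monoˡ-≤ ℚ.∣ b ℚ.- d ∣ (ℚ.∣p-q∣≤∣p∣+∣q∣ (a ℚ.- b) (e ℚ.- d)) ⟩
        ℚ.∣ a ℚ.- b ∣ ℚ.+ ℚ.∣ e ℚ.- d ∣ ℚ.+ ℚ.∣ b ℚ.- d ∣
          <⟨ ℚ.+-mono-< (ℚ.+-mono-< am en) bd ⟩
        h′ ℚ.+ h′ ℚ.+ h
          ≡⟨ trans (cong (ℚ._+ h) (½+½ h)) (½+½ ε) ⟩
        ε ∎
    where
    open ℚ.≤-Reasoning
    open +-*-Solver

  module _ {r : ℚ} (0≤r : 0ℚ ≤ r) (r<1 : r < 1ℚ) where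
    open Rationals.Geometric 0≤r r<1

    GeometricallyCauchy : (ℕ → ℂ) → Set
    GeometricallyCauchy F = ∃ λ C → 0ℚ ≤ C × Eventually λ n → ∀ {m m′} → m ℕ.≤ m′ →
      at (F m′) n - at (F m) n ⊑ C ℚ.* r ^ℚ m

    -- The last component records the exact approximations of the limit, so that the final identity
    -- can be checked index by index. For convergence, `F n - L` is inspected at indices m ≥ n,
    -- where it equals `F n - F m`.
    limit : ∀ F → GeometricallyCauchy F → ∃ λ L → F ⟶ L × (∀ n → at L n ≡ at (F n) n)
    limit F (C , 0≤C , N , p) = L , converges , at-L
      where
      close : ∀ {ε} → 0ℚ < ε → ∃ λ K → ∀ n → K ℕ.≤ n → at (F n) n - at (F K) n ⊑ C ℚ.* r ^ℚ K × C ℚ.* r ^ℚ K < ε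
      close 0<ε = let M , q = *^-null C 0≤C 0<ε in
        N ℕ.⊔ M , λ n K≤n → p n (ℕ.m⊔n≤o⇒m≤o N M K≤n) K≤n , q (N ℕ.⊔ M) (ℕ.m≤n⊔m N M)
      L : ℂ
      L = diagonal (λ n → re (F n)) (λ 0<ε → let K , c = close 0<ε in K , λ n K≤n →
            subst (λ d → ℚ.∣ d ∣ < _) (sym (re-diff (F n) (F K) n))
              (ℚ.≤-<-trans (∣Re∣≤ (proj₁ (c n K≤n))) (proj₂ (c n K≤n))))
        +i diagonal (λ n → im (F n)) (λ 0<ε → let K , c = close 0<ε in K , λ n K≤n →
            subst (λ d → ℚ.∣ d ∣ < _) (sym (im-diff (F n) (F K) n))
              (ℚ.≤-<-trans (∣Im∣≤ (proj₁ (c n K≤n))) (proj₂ (c n K≤n))))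
      opaque
        unfolding at
        at-L : ∀ n → at L n ≡ at (F n) n
        at-L n = refl
      converges : F ⟶ L
      converges 0<ε = let M , q = *^-null C 0≤C 0<ε in M , λ n M≤n →
        ∣∣<-intro {F n Defs.- L} (0≤*0≤ 0≤C (0≤^ n)) (q n M≤n) (N ℕ.⊔ n , λ m ≤m →
          subst (_⊑ C ℚ.* r ^ℚ n)
            (trans (solve 2 (λ a b → :- (b :- a) := a :- b) refl (at (F n) m) (at (F m) m))
              (sym (trans (at-- (F n) L m) (cong (λ l → at (F n) m - l) (at-L m)))))
            (⊑-neg (p m (ℕ.m⊔n≤o⇒m≤o N n ≤m) (ℕ.m⊔n≤o⇒n≤o N n ≤m))))
        where open Solver

    ≈-intro : ∀ {z w} C → 0ℚ ≤ C → Eventually (λ n → at z n - at w n ⊑ C ℚ.* r ^ℚ n) → z ≈ w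
    ≈-intro {z} {w} C 0≤C (N , p) =
        (λ 0<ε → let M , q = *^-null C 0≤C 0<ε in N ℕ.⊔ M , λ n ≤n →
          subst (λ d → ℚ.∣ d ∣ < _) (sym (re-diff z w n))
            (ℚ.≤-<-trans (∣Re∣≤ (p n (ℕ.m⊔n≤o⇒m≤o N M ≤n))) (q n (ℕ.m⊔n≤o⇒n≤o N M ≤n))))
      , (λ 0<ε → let M , q = *^-null C 0≤C 0<ε in N ℕ.⊔ M , λ n ≤n →
          subst (λ d → ℚ.∣ d ∣ < _) (sym (im-diff z w n))
            (ℚ.≤-<-trans (∣Im∣≤ (p n (ℕ.m⊔n≤o⇒m≤o N M ≤n))) (q n (ℕ.m⊔n≤o⇒n≤o N M ≤n))))

-- The infinite products and the series for a given q, and the identity between them.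

module Assembly (q : ℂ) (q-in-disc : Evaluation.EventuallyInDisc q) (k : ℕ) where
  open Evaluation.EventuallyInDisc q-in-disc
    renaming (radius to r; 0≤radius to 0≤r; radius<1 to r<1; start to N₀; at⊑radius to q⊑r)
  open Gaussian
  open Norm
  open Evaluation
  open QSeries 0≤r r<1
  open Uniform 0≤r r<1 using (UniformlyCauchy; Family; Small; small-*; small-neg; small-const≥0)
  open Solver
  open ≡-Reasoning

  private
    :1 : ∀ {n} → Polynomial n
    :1 = con 1ℚ
    :2 : ∀ {n} → Polynomial n
    :2 = :1 :+ :1

  at-P : ∀ n m → at (qfac (Defs.- q) q n) m ≡ P (at q m) n
  at-P n m = trans (at-qfac (Defs.- q) q n m) (cong (λ a → qfac𝔾 a (at q m) n) (at-neg q m))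

  at-Q : ∀ n m → at (qfac q q n) m ≡ Q (at q m) n
  at-Q n m = at-qfac q q n m

  -- The first factor of (-1;x)_(i+1) is 2, and the remaining ones are the factors of (-x;x)_i.
  qfac-1 : ∀ x i → qfac𝔾 (- 1#) x (suc i) ≡ 2# * P x i
  qfac-1 x zero    = solve 0 (:1 :* (:1 :- (:- :1) :* :1) := :2 :* :1) refl
  qfac-1 x (suc i) = trans (cong (_* (1# - (- 1#) * (x * x ^ i))) (qfac-1 x i))
    (solve 3 (λ p x a → :2 :* p :* (:1 :- (:- :1) :* (x :* a)) := :2 :* (p :* (:1 :- (:- x) :* a))) refl (P x i) x (x ^ i))

  at-N : ∀ i m → at (qfac (Defs.- 1ℂ) q (suc i)) m ≡ 2# * P (at q m) i
  at-N i m = trans (at-qfac (Defs.- 1ℂ) q (suc i) m)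
    (trans (cong (λ a → qfac𝔾 a (at q m) (suc i)) (trans (at-neg 1ℂ m) (cong (λ y → - y) (at-1 m)))) (qfac-1 (at q m) i))

  nz : QfacNonZero q
  nz n = let δ , 0<δ , δ≤ = normSq-Q-≥ in
    nonZero-intro {qfac q q n} 0<δ (N₀ , λ m N₀≤m → subst (λ y → δ ≤ normSq y) (sym (at-Q n m)) (δ≤ (at q m) (q⊑r m N₀≤m) n))

  0<normSq-Q : ∀ {x} → x ⊑ r → ∀ n → 0ℚ < normSq (Q x n)
  0<normSq-Q {x} x⊑r n = let δ , 0<δ , δ≤ = normSq-Q-≥ in ℚ.<-≤-trans 0<δ (δ≤ x x⊑r n)

  Q⁻¹ : ∀ {x} → x ⊑ r → ∀ n → Q x n ⁻¹ ≡ V x n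
  Q⁻¹ {x} x⊑r n = ⁻¹-unique (Q x n) (V x n) (0<normSq-Q x⊑r n) (Q*V x x⊑r n)

  Q*Q⁻¹ : ∀ {x} → x ⊑ r → ∀ m n → (Q x m * Q x n) ⁻¹ ≡ V x m * V x n
  Q*Q⁻¹ {x} x⊑r m n = ⁻¹-unique _ _
    (subst (0ℚ <_) (sym (normSq-* (Q x m) (Q x n))) (0<*0< (0<normSq-Q x⊑r m) (0<normSq-Q x⊑r n)))
    (begin
      Q x m * Q x n * (V x m * V x n)      ≡⟨ solve 4 (λ a b c d → a :* b :* (c :* d) := a :* c :* (b :* d)) refl (Q x m) (Q x n) (V x m) (V x n) ⟩
      Q x m * V x m * (Q x n * V x n)      ≡⟨ cong₂ _*_ (Q*V x x⊑r m) (Q*V x x⊑r n) ⟩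
      1# * 1#                              ≡⟨ *-identityˡ 1# ⟩
      1#                                   ∎)

  opaque
    unfolding at

    at-term : ∀ n m → at ((qfac (Defs.- q) q k Defs.* qfac (Defs.- 1ℂ) q (n ∸ k) Defs.* q Defs.^ (suc k ℕ.* n)) Defs./ qfac q q n ⟨ nz n ⟩
        Defs.* qbinom q nz (n ∸ 1) k) m ≡
      at (qfac (Defs.- q) q k) m * at (qfac (Defs.- 1ℂ) q (n ∸ k)) m * at (q Defs.^ (suc k ℕ.* n)) m
        * at (qfac q q n) m ⁻¹
        * (at (qfac q q (n ∸ 1)) m * (at (qfac q q k) m * at (qfac q q (n ∸ 1 ∸ k)) m) ⁻¹)
    at-term n m = refl

  module _ (m : ℕ) (N₀≤m : N₀ ℕ.≤ m) where
    private
      x : 𝔾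
      x = at q m
      x⊑r : x ⊑ r
      x⊑r = q⊑r m N₀≤m

    at-term-𝔾 : ∀ n {i j} → n ∸ k ≡ suc i → n ∸ 1 ≡ j → n ∸ 1 ∸ k ≡ i → at ((qfac (Defs.- q) q k Defs.* qfac (Defs.- 1ℂ) q (n ∸ k) Defs.* q Defs.^ (suc k ℕ.* n)) Defs./ qfac q q n ⟨ nz n ⟩
        Defs.* qbinom q nz (n ∸ 1) k) m ≡
      P x k * (2# * P x i) * x ^ (suc k ℕ.* n) * V x n * (Q x j * (V x k * V x i))
    at-term-𝔾 n {i} {j} n∸k n∸1 n∸1∸k = trans (at-term n m) (cong₂ _*_
      (cong₂ _*_
        (cong₂ _*_
          (cong₂ _*_ (at-P k m) (trans (cong (λ c → at (qfac (Defs.- 1ℂ) q c) m) n∸k) (at-N i m)))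
          (at-^ q (suc k ℕ.* n) m))
        (trans (cong _⁻¹ (at-Q n m)) (Q⁻¹ x⊑r n)))
      (cong₂ _*_
        (trans (cong (λ c → at (qfac q q c) m) n∸1) (at-Q j m))
        (trans
          (cong _⁻¹ (cong₂ _*_ (at-Q k m) (trans (cong (λ c → at (qfac q q c) m) n∸1∸k) (at-Q i m))))
          (Q*Q⁻¹ x⊑r k i))))

    -- `n` stays a variable, tied to k + 1 + i by an equation, so that unification can recover the
    -- summand as a function of `n`.
    at-Y : ∀ n i → n ≡ suc k ℕ.+ i → at ((qfac (Defs.- q) q k Defs.* qfac (Defs.- 1ℂ) q (n ∸ k) Defs.* q Defs.^ (suc k ℕ.* n)) Defs./ qfac q q n ⟨ nz n ⟩
        Defs.* qbinom q nz (n ∸ 1) k) m ≡ Y k x i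
    at-Y n i refl = trans
      (at-term-𝔾 n (trans (cong (_∸ k) (sym (ℕ.+-suc k i))) (ℕ.m+n∸m≡n k (suc i))) refl (ℕ.m+n∸m≡n k i))
      (collect (x ^ (suc k ℕ.* suc (k ℕ.+ i))))
      where
      j = k ℕ.+ i
      collect : ∀ e → P x k * (2# * P x i) * e * (V x j * u x j) * (Q x j * (V x k * V x i)) ≡
        2# * R x k * R x i * e * u x j
      collect e = begin
        P x k * (2# * P x i) * e * (V x j * u x j) * (Q x j * (V x k * V x i))
          ≡⟨ solve 8 (λ p p′ e v u q w w′ →
               p :* (:2 :* p′) :* e :* (v :* u) :* (q :* (w :* w′)) := :2 :* (p :* w) :* (p′ :* w′) :* e :* u :* (q :* v))
               refl (P x k) (P x i) e (V x j) (u x j) (Q x j) (V x k) (V x i) ⟩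
        2# * (P x k * V x k) * (P x i * V x i) * e * u x j * (Q x j * V x j)
          ≡⟨ cong₂ (λ a b → 2# * a * b * e * u x j * (Q x j * V x j)) (P*V x k) (P*V x i) ⟩
        2# * R x k * R x i * e * u x j * (Q x j * V x j)
          ≡⟨ cong (2# * R x k * R x i * e * u x j *_) (Q*V x x⊑r j) ⟩
        2# * R x k * R x i * e * u x j * 1#
          ≡⟨ *-identityʳ _ ⟩
        2# * R x k * R x i * e * u x j ∎

    at-S : ∀ f → (∀ n i → n ≡ suc k ℕ.+ i → at (f n) m ≡ Y k x i) → ∀ M → at (sum (suc k) M f) m ≡ S k x M
    at-S f at-f zero    = at-0 m
    at-S f at-f (suc M) = trans (at-sum-suc (suc k) M f m) (cong₂ _+_ (at-S f at-f M) (at-f (suc k ℕ.+ M) M refl))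

  at-sgn : ∀ j m → at ((Defs.- 1ℂ) Defs.^ j) m ≡ sgn j
  at-sgn j m = trans (at-^ (Defs.- 1ℂ) j m) (cong (_^ j) (trans (at-neg 1ℂ m) (cong (λ y → - y) (at-1 m))))

  opaque
    unfolding at

    at-θ-factors : ∀ j m → at ((Defs.- 1ℂ) Defs.^ j Defs.* q Defs.^ (j ℕ.^ 2)) m ≡
      at ((Defs.- 1ℂ) Defs.^ j) m * at (q Defs.^ (j ℕ.^ 2)) m
    at-θ-factors j m = refl

  at-θ-term : ∀ j m → at ((Defs.- 1ℂ) Defs.^ j Defs.* q Defs.^ (j ℕ.^ 2)) m ≡ sgn j * at q m ^ (j ℕ.^ 2)
  at-θ-term j m = trans (at-θ-factors j m) (cong₂ _*_ (at-sgn j m) (at-^ q (j ℕ.^ 2) m))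

  at-θ : ∀ {f} → (∀ j m → at (f j) m ≡ sgn j * at q m ^ (j ℕ.^ 2)) → ∀ j m → at (sum 1 j f) m ≡ θ j (at q m)
  at-θ {f} at-f zero    m = at-0 m
  at-θ {f} at-f (suc j) m = trans (at-sum-suc 1 j f m) (cong₂ _+_ (at-θ at-f j m) (at-f (1 ℕ.+ j) m))

  geometricallyCauchy : ∀ {F : ℕ → ℂ} {f : Family} → UniformlyCauchy f →
    (∀ m → N₀ ℕ.≤ m → ∀ n → at (F n) m ≡ f (at q m) n) → GeometricallyCauchy 0≤r r<1 F
  geometricallyCauchy (C , 0≤C , p) eq = C , 0≤C , N₀ , λ m N₀≤m {n} {n′} n≤n′ →
    subst (_⊑ _) (sym (cong₂ _-_ (eq m N₀≤m n′) (eq m N₀≤m n))) (p (at q m) (q⊑r m N₀≤m) n≤n′)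

  limit-P = limit 0≤r r<1 (qfac (Defs.- q) q) (geometricallyCauchy P-cauchy (λ m _ n → at-P n m))
  limit-Q = limit 0≤r r<1 (qfac q q) (geometricallyCauchy Q-cauchy (λ m _ n → at-Q n m))
  limit-S : ∀ {f} → (∀ m → N₀ ℕ.≤ m → ∀ n i → n ≡ suc k ℕ.+ i → at (f n) m ≡ Y k (at q m) i) →
    ∃ λ L → IsSum (suc k) f L × (∀ m → N₀ ℕ.≤ m → at L m ≡ S k (at q m) m)
  limit-S {f} at-f =
    let L , f⟶L , at-L = limit 0≤r r<1 (λ M → sum (suc k) M f)
          (geometricallyCauchy (S-cauchy k) (λ m N₀≤m → at-S m N₀≤m f (at-f m N₀≤m)))
    in L , f⟶L , λ m N₀≤m → trans (at-L m) (at-S m N₀≤m f (at-f m N₀≤m) m)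

  A B : ℂ
  A = proj₁ limit-P
  B = proj₁ limit-Q

  at-A : ∀ m → at A m ≡ P (at q m) m
  at-A m = trans (proj₂ (proj₂ limit-P) m) (at-P m m)

  at-B : ∀ m → at B m ≡ Q (at q m) m
  at-B m = trans (proj₂ (proj₂ limit-Q) m) (at-Q m m)

  B≠0 : NonZero B
  B≠0 = let δ , 0<δ , δ≤ = normSq-Q-≥ in
    nonZero-intro {B} 0<δ (N₀ , λ m N₀≤m → subst (λ y → δ ≤ normSq y) (sym (at-B m)) (δ≤ (at q m) (q⊑r m N₀≤m) m))

  opaque
    unfolding at

    at-lhs : ∀ T m → at ((A Defs./ B ⟨ B≠0 ⟩) Defs.* (1ℂ Defs.+ Defs.2ℂ Defs.* T)) m ≡
      at A m * at B m ⁻¹ * (1# + 2# * at T m)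
    at-lhs T m = refl

    at-rhs : ∀ L m → at (1ℂ Defs.+ (Defs.- 1ℂ) Defs.^ k Defs.* L) m ≡
      1# + at ((Defs.- 1ℂ) Defs.^ k) m * at L m
    at-rhs L m = refl

  small-difference : Small (λ x n → - (sgn k * error k x n))
  small-difference = small-neg (small-* (bounded-sgn k) (small-error k))

  -- The definition of `error` is solved for the product side by multiplying with `sgn k`, which is
  -- its own inverse.
  difference : ∀ x m →
    R x m * (1# + 2# * θ k x) - (1# + sgn k * S k x m) ≡ - (sgn k * error k x m)
  difference x m = begin
    R x m * (1# + 2# * θ k x) - (1# + sgn k * S k x m)
      ≡⟨ solve 3 (λ y s t → y :- (:1 :+ s :* t) := :1 :* (y :- :1) :- s :* t) refl
           (R x m * (1# + 2# * θ k x)) (sgn k) (S k x m) ⟩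
    1# * (R x m * (1# + 2# * θ k x) - 1#) - sgn k * S k x m
      ≡⟨ cong (λ i → i * (R x m * (1# + 2# * θ k x) - 1#) - sgn k * S k x m) (sgn² k) ⟨
    sgn k * sgn k * (R x m * (1# + 2# * θ k x) - 1#) - sgn k * S k x m
      ≡⟨ solve 3 (λ y s t → s :* s :* y :- s :* t := :- (s :* (t :- s :* y))) refl
           (R x m * (1# + 2# * θ k x) - 1#) (sgn k) (S k x m) ⟩
    - (sgn k * error k x m) ∎

  at-A/B : ∀ m → N₀ ℕ.≤ m → at A m * at B m ⁻¹ ≡ R (at q m) m
  at-A/B m N₀≤m = trans (cong₂ (λ a b → a * b ⁻¹) (at-A m) (at-B m))
    (trans (cong (P (at q m) m *_) (Q⁻¹ (q⊑r m N₀≤m) m)) (P*V (at q m) m))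

  module _ {T L : ℂ} (at-T : ∀ m → at T m ≡ θ k (at q m)) (at-L : ∀ m → N₀ ℕ.≤ m → at L m ≡ S k (at q m) m) where

    at-difference : ∀ m → N₀ ℕ.≤ m →
      at ((A Defs./ B ⟨ B≠0 ⟩) Defs.* (1ℂ Defs.+ Defs.2ℂ Defs.* T)) m
        - at (1ℂ Defs.+ (Defs.- 1ℂ) Defs.^ k Defs.* L) m
      ≡ - (sgn k * error k (at q m) m)
    at-difference m N₀≤m = trans
      (cong₂ _-_
        (trans (at-lhs T m) (cong₂ (λ y t → y * (1# + 2# * t)) (at-A/B m N₀≤m) (at-T m)))
        (trans (at-rhs L m) (cong₂ (λ s y → 1# + s * y) (at-sgn k m) (at-L m N₀≤m))))
      (difference (at q m) m)

    -- All three limits being diagonal, the m-th approximations of both sides are the finite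
    -- expressions with m terms or factors, evaluated at the m-th approximation of q. They differ by
    -- the error term alone, which is O(r^m).
    identity : (A Defs./ B ⟨ B≠0 ⟩) Defs.* (1ℂ Defs.+ Defs.2ℂ Defs.* T) ≈ 1ℂ Defs.+ (Defs.- 1ℂ) Defs.^ k Defs.* L
    identity = ≈-intro 0≤r r<1 (Small.const small-difference) (small-const≥0 small-difference)
      (N₀ , λ m N₀≤m → subst (_⊑ _) (sym (at-difference m N₀≤m))
        (Small.bound small-difference (at q m) (q⊑r m N₀≤m) m))

  -- Without type signatures: the summands are then inferred from at-Y and at-θ-term, whereas
  -- checking against a type would compare complex numbers and unfold their Cauchy proofs.
  limit-sum = limit-S at-Y
  sum-converges = proj₁ (proj₂ limit-sum)
  at-θ-sum = at-θ at-θ-term k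
  sum-identity = identity at-θ-sum (proj₂ (proj₂ limit-sum))

open Defs using (_+_; _*_; -_; ∣_∣; _^_; _/_⟨_⟩; 2ℂ)

theorem1p1 : (q : ℂ) → ∣ q ∣ <ᴿ 1ᴿ → (k : ℕ) → 1 ℕ.≤ k →
    Σ[ nz ∈ QfacNonZero q ]
    ∃[ A ] ∃[ B ] ∃[ S ]
    Σ[ B≠0 ∈ NonZero B ]
    (IsQfac∞ (- q) q A
    × IsQfac∞ q q B
    × IsSum (suc k)
    (λ n → (qfac (- q) q k * qfac (- 1ℂ) q (n ∸ k) * q ^ (suc k ℕ.* n)) / qfac q q n ⟨ nz n ⟩
    * qbinom q nz (n ∸ 1) k)
    S
    × (A / B ⟨ B≠0 ⟩) * (1ℂ + 2ℂ * sum 1 k (λ j → (- 1ℂ) ^ j * q ^ (j ℕ.^ 2)))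
    ≈ 1ℂ + (- 1ℂ) ^ k * S)
theorem1p1 q ∣q∣<1 k 1≤k =
  nz q d k , A q d k , B q d k , proj₁ (limit-sum q d k) , B≠0 q d k
  , proj₁ (proj₂ (limit-P q d k)) , proj₁ (proj₂ (limit-Q q d k)) , sum-converges q d k , sum-identity q d k
  where
  open Assembly
  d = Evaluation.∣∣<1-elim q ∣q∣<1
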